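{- Let $k\ge 2$ be an integer and let $q=\lfloor k/3\rfloor$. There exists a connected graph of order $n$ whose metric subgraphs are all connected and $k$-regular if and only if: (1) $n\ge 14q+6$, when $k\equiv 0 \pmod 3$ and $q$ is even; (2) $n$ is even and $n\ge 14q+8$, when $k\equiv 0 \pmod 3$ and $q$ is odd; (3) $n$ is even and $n\ge 14q+12$, when $k\equiv 1 \pmod 3$ and $q$ is even; (4) $n\ge 14q+11$, when $k\equiv 1 \pmod 3$ and $q$ is odd; (5) $n\ge 14q+15$, when $k\equiv 2 \pmod 3$ and $q$ is even; (6) $n$ is even and $n\ge 14q+16$, when $k\equiv 2 \pmod 3$ and $q$ is odd.
   Context: All graphs are finite and simple. For a connected graph $G$ and vertices $u,v$, $d(u,v)$ is the distance between them; the eccentricity of $v$ is $e(v)=\max\{d(v,u): u\in V(G)\}$; $\mathrm{rad}(G)$ and $\mathrm{diam}(G)$ are the minimum and maximum eccentricities. The center $C(G)$ is the set of vertices $v$ with $e(v)=\mathrm{rad}(G)$; the periphery $P(G)$ is the set of vertices with $e(v)=\mathrm{diam}(G)$; the annulus $A(G)$ is the set of vertices $w$ with $\mathrm{rad}(G)<e(w)<\mathrm{diam}(G)$. The subgraphs of $G$ induced by $C(G)$, $A(G)$, $P(G)$ are the central, annular and peripheral subgraphs, collectively the metric subgraphs of $G$. The order of a graph is its number of vertices; a connected graph here is non-null (has at least one vertex). -}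

module Defs where

open import Data.Nat using (ℕ; zero; suc; _+_; _*_; _≤_; _<_; _/_; _%_)
open import Data.Fin using (Fin)
open import Data.Bool using (Bool; true; false)
open import Data.List using (List; length)
open import Data.List.Relation.Unary.Unique.Propositional using (Unique)
open import Data.List.Membership.Propositional using (_∈_)
open import Data.Product using (Σ; ∃; ∃-syntax; _×_; _,_)
open import Data.Unit using (⊤)
open import Function.Bundles using (_⇔_)
open import Relation.Binary.PropositionalEquality using (_≡_)

record Graph (n : ℕ) : Set where
  field
    adj    : Fin n → Fin n → Bool
    sym    : ∀ u v → adj u v ≡ adj v u
    irrefl : ∀ v → adj v v ≡ false
open Graph public

module _ {n : ℕ} (G : Graph n) where

  data WalkIn (S : Fin n → Set) : Fin n → Fin n → ℕ → Set where
    here : ∀ {u} → S u → WalkIn S u u 0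
    step : ∀ {u w v m} → S u → adj G u w ≡ true → WalkIn S w v m → WalkIn S u v (suc m)

  Walk : Fin n → Fin n → ℕ → Set
  Walk = WalkIn (λ _ → ⊤)

  ConnectedOn : (Fin n → Set) → Set
  ConnectedOn S = (∃[ v ] S v) × (∀ u v → S u → S v → ∃[ m ] WalkIn S u v m)

  Connected : Set
  Connected = ConnectedOn (λ _ → ⊤)

  RegularOn : ℕ → (Fin n → Set) → Set
  RegularOn k S = ∀ v → S v →
    ∃[ L ] (Unique L × length L ≡ k × (∀ w → (w ∈ L) ⇔ (S w × adj G v w ≡ true)))

  Dist : Fin n → Fin n → ℕ → Set
  Dist u v d = Walk u v d × (∀ m → Walk u v m → d ≤ m)

  Ecc : Fin n → ℕ → Set
  Ecc v e = (∀ u → ∃[ d ] (Dist v u d × d ≤ e)) × (∃[ u ] Dist v u e)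

  Rad : ℕ → Set
  Rad r = (∃[ v ] Ecc v r) × (∀ v e → Ecc v e → r ≤ e)

  Diam : ℕ → Set
  Diam D = (∃[ v ] Ecc v D) × (∀ v e → Ecc v e → e ≤ D)

  Center : Fin n → Set
  Center v = ∃[ r ] (Rad r × Ecc v r)

  Periphery : Fin n → Set
  Periphery v = ∃[ D ] (Diam D × Ecc v D)

  Annulus : Fin n → Set
  Annulus v = ∃[ r ] ∃[ D ] ∃[ e ] (Rad r × Diam D × Ecc v e × r < e × e < D)

  MetricConnectedRegular : ℕ → Set
  MetricConnectedRegular k =
    (ConnectedOn Center × RegularOn k Center) ×
    (ConnectedOn Annulus × RegularOn k Annulus) ×
    (ConnectedOn Periphery × RegularOn k Periphery)

OrderCondition : ℕ → ℕ → Set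
OrderCondition k n =
  (k % 3 ≡ 0 → q % 2 ≡ 0 → 14 * q + 6 ≤ n) ×
  (k % 3 ≡ 0 → q % 2 ≡ 1 → (n % 2 ≡ 0 × 14 * q + 8 ≤ n)) ×
  (k % 3 ≡ 1 → q % 2 ≡ 0 → (n % 2 ≡ 0 × 14 * q + 12 ≤ n)) ×
  (k % 3 ≡ 1 → q % 2 ≡ 1 → 14 * q + 11 ≤ n) ×
  (k % 3 ≡ 2 → q % 2 ≡ 0 → 14 * q + 15 ≤ n) ×
  (k % 3 ≡ 2 → q % 2 ≡ 1 → (n % 2 ≡ 0 × 14 * q + 16 ≤ n))
  where q = k / 3

module Submission where

-- Write C, A, P for the center, annulus and periphery, and let r be the radius and D the diameter, so that
-- 4 ≤ r + 2 ≤ D.  Then |C| ≥ k + 1, and |A| ≥ k + 2 because the annulus cannot be a clique.  Each peripheral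
-- vertex has an antipode at distance D ≥ 4 in the periphery; from a geodesic of length 4 and the antipodes of
-- its vertices one gets eight closed neighbourhoods in the periphery covering no vertex more than three times,
-- so 8(k + 1) ≤ 3|P|.  If k is odd, all three orders are even.  Adding up gives the bounds on n.
--
-- Conversely, take a circulant graph as center, two cliques joined by a nearly complete bipartite graph on
-- k + 2 or k + 3 vertices as annulus, and a blown-up 8-cycle as periphery.  Join every central vertex to every
-- annular vertex and every peripheral vertex to one annular vertex, its foot, such that vertices at opposite
-- positions of the 8-cycle have non-adjacent feet.  The eccentricities are then 2, 3 and 4.

open import Algebra.Properties.Semiring.Sum as SemiringSum using ()
open import Data.Bool.Base using (Bool; true; false; _∧_; _∨_; not; if_then_else_)
import Data.Bool.Properties as Boolₚ
open import Data.Empty using (⊥; ⊥-elim)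
open import Data.Fin using (Fin; zero; suc; toℕ; inject₁; fromℕ; fromℕ<; splitAt; join)
open import Data.Fin.Induction using (<-weakInduction)
open import Data.Fin.Patterns
open import Data.Fin.Properties using
  (_≟_; any?; all?; toℕ≤pred[n]; toℕ<n; toℕ-inject₁; toℕ-fromℕ<; fromℕ<-toℕ; splitAt-join; join-splitAt; +↔⊎; *↔×)
open import Data.Fin.Relation.Unary.Top using (view; ‵fromℕ; ‵inject₁; view-fromℕ; view-inject₁)
open import Data.List.Base using (List; []; _∷_; length; map; _++_; filter; tabulate; allFin; cartesianProduct)
open import Data.List.Membership.DecPropositional using () renaming (_∈?_ to mem?)
open import Data.List.Membership.Propositional using (_∈_)
open import Data.List.Membership.Propositional.Properties
open import Data.List.Properties using (length-map; length-++; length-tabulate)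
open import Data.List.Relation.Unary.All as All using (All; []; _∷_)
open import Data.List.Relation.Unary.AllPairs using ([]; _∷_)
import Data.List.Relation.Unary.Any as Any
open import Data.List.Relation.Unary.Unique.Propositional using (Unique)
import Data.List.Relation.Unary.Unique.Propositional.Properties as Uniqueₚ
open import Data.Nat hiding (_≟_)
open import Data.Nat.DivMod using (m≡m%n+[m/n]*n; m%n<n; [m+kn]%n≡m%n)
open import Data.Nat.Divisibility using (_∣_; divides; divides-refl; n∣m⇒m%n≡0; m%n≡0⇒n∣m; ∣m+n∣m⇒∣n; _∣0; ∣m∣n⇒∣m+n)
open import Data.Nat.Primality using (prime?; euclidsLemma)
open import Data.Nat.Properties hiding (_≟_)
import Data.Nat.Properties as ℕₚ
open import Data.Nat.Tactic.RingSolver using (solve-∀)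
open import Data.Product using (Σ; ∃-syntax; _×_; _,_; proj₁; proj₂)
import Data.Product.Properties as Productₚ
open import Data.Sum.Base using (_⊎_; inj₁; inj₂; [_,_]′; swap)
open import Data.Sum.Function.Propositional using (_⊎-↔_)
open import Data.Sum.Properties using (inj₁-injective; inj₂-injective)
import Data.Sum.Properties as Sumₚ
open import Data.Unit using (⊤; tt)
open import Data.Vec.Base as Vec using (Vec; []; _∷_)
open import Defs
open import Function.Base using (_∘_; id; case_of_)
open import Function.Bundles using (_⇔_; mk⇔; Equivalence; _↔_; Inverse)
open import Function.Properties.Inverse using (↔-refl; ↔-sym; ↔-trans)
open import Relation.Binary.Construct.Closure.ReflexiveTransitive using (Star; ε; _◅_; _◅◅_)
open import Relation.Binary.PropositionalEquality renaming (sym to ≡sym)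
open import Relation.Nullary
open import Relation.Nullary.Decidable using (from-yes; dec-true; dec-false; map′; _×-dec_; _→-dec_; _⊎-dec_; ¬?)

open SemiringSum +-*-semiring
open Equivalence using (to; from)

-- The constants in `OrderCondition` are sums of three separate minima. For `k = 3q + i` the least
-- `|P|` with `8(k + 1) ≤ 3|P|` is `8q + 3`, `8q + 6` or `8q + 8` for `i = 0, 1, 2`; when `k` is
-- odd, whichever of `k + 2` and this number is odd goes up by one. The construction attains all
-- minima at once and puts surplus vertices into the center, where circulants exist for every
-- admissible order. The difficulty of the converse lies in shortcuts through the annulus:
-- peripheral vertices with feet `a` and `b` are at distance at most `2 + d(a, b)`, and paths may
-- mix steps inside the periphery with steps through feet. A potential that changes by at most one
-- along each edge bounds all of these paths from below at once.

-- Counting by lists without repetition and by sums of indicators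

HasCount : {V : Set} → (V → Set) → ℕ → Set
HasCount T k = ∃[ L ] (Unique L × length L ≡ k × (∀ w → (w ∈ L) ⇔ T w))

module _ {V : Set} where

  count-cong : {T T' : V → Set} {k : ℕ} → (∀ w → T w ⇔ T' w) → HasCount T k → HasCount T' k
  count-cong T⇔T' (L , unique , len , mem) =
    L , unique , len , λ w → mk⇔ (to (T⇔T' w) ∘ to (mem w)) (from (mem w) ∘ from (T⇔T' w))

  remove : {x : V} {L : List V} → Unique L → x ∈ L →
           ∃[ L' ] (Unique L' × suc (length L') ≡ length L × (∀ w → (w ∈ L') ⇔ (w ∈ L × w ≢ x)))
  remove {L = x ∷ xs} (x∉xs ∷ unique) (Any.here refl) =
    xs , unique , refl , λ w → mk⇔
      (λ w∈xs → Any.there w∈xs , λ w≡x → All.lookup x∉xs w∈xs (≡sym w≡x))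
      (λ { (Any.here w≡x , w≢x) → ⊥-elim (w≢x w≡x) ; (Any.there w∈xs , _) → w∈xs })
  remove {L = y ∷ xs} (y∉xs ∷ unique) (Any.there x∈xs) with remove unique x∈xs
  ... | L' , unique' , len , mem =
    y ∷ L' , All.tabulate (λ {w} w∈L' → All.lookup y∉xs (proj₁ (to (mem w) w∈L'))) ∷ unique' , cong suc len , λ w → mk⇔
      (λ { (Any.here refl) → Any.here refl , λ w≡x → All.lookup y∉xs x∈xs w≡x
         ; (Any.there w∈L') → Any.there (proj₁ (to (mem w) w∈L')) , proj₂ (to (mem w) w∈L') })
      (λ { (Any.here w≡y , _) → Any.here w≡y
         ; (Any.there w∈xs , w≢x) → Any.there (from (mem w) (w∈xs , w≢x)) })

  count-remove : {T : V → Set} {k : ℕ} (x : V) → T x → HasCount T (suc k) → HasCount (λ w → T w × w ≢ x) k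
  count-remove x Tx (L , unique , len , mem) with remove unique (from (mem x) Tx)
  ... | L' , unique' , len' , mem' =
    L' , unique' , suc-injective (trans len' len) , λ w → mk⇔
      (λ w∈L' → to (mem w) (proj₁ (to (mem' w) w∈L')) , proj₂ (to (mem' w) w∈L'))
      (λ (Tw , w≢x) → from (mem' w) (from (mem w) Tw , w≢x))

module _ {V W : Set} where

  count-image : {T : W → Set} {k : ℕ} (ι : V → W) → (∀ {x y} → ι x ≡ ι y → x ≡ y) →
                (∀ w → T w → ∃[ x ] w ≡ ι x) → HasCount (T ∘ ι) k → HasCount T k
  count-image {T} ι ι-injective onto (L , unique , len , mem) =
    map ι L , Uniqueₚ.map⁺ ι-injective unique , trans (length-map ι L) len , λ w → mk⇔
      (λ w∈ → let x , x∈L , w≡ιx = ∈-map⁻ ι w∈ in subst T (≡sym w≡ιx) (to (mem x) x∈L))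
      (λ Tw → let x , w≡ιx = onto w Tw in
        subst (_∈ map ι L) (≡sym w≡ιx) (∈-map⁺ ι (from (mem x) (subst T w≡ιx Tw))))

  count-⊎ : {T : V ⊎ W → Set} {a b : ℕ} →
            HasCount (T ∘ inj₁) a → HasCount (T ∘ inj₂) b → HasCount T (a + b)
  count-⊎ {T} (L , uniqueL , refl , memL) (M , uniqueM , refl , memM) =
    map inj₁ L ++ map inj₂ M ,
    Uniqueₚ.++⁺ (Uniqueₚ.map⁺ inj₁-injective uniqueL) (Uniqueₚ.map⁺ inj₂-injective uniqueM) disjoint ,
    trans (length-++ (map inj₁ L)) (cong₂ _+_ (length-map inj₁ L) (length-map inj₂ M)) ,
    λ w → mk⇔ (forth w) (back w)
    where
    disjoint : ∀ {w} → w ∈ map inj₁ L × w ∈ map inj₂ M → ⊥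
    disjoint (p , q) with ∈-map⁻ inj₁ p | ∈-map⁻ inj₂ q
    ... | _ , _ , refl | _ , _ , ()
    forth : ∀ w → w ∈ map inj₁ L ++ map inj₂ M → T w
    forth w w∈ with ∈-++⁻ (map inj₁ L) w∈
    ... | inj₁ p = let x , x∈L , eq = ∈-map⁻ inj₁ p in subst T (≡sym eq) (to (memL x) x∈L)
    ... | inj₂ p = let x , x∈M , eq = ∈-map⁻ inj₂ p in subst T (≡sym eq) (to (memM x) x∈M)
    back : ∀ w → T w → w ∈ map inj₁ L ++ map inj₂ M
    back (inj₁ x) Tx = ∈-++⁺ˡ (∈-map⁺ inj₁ (from (memL x) Tx))
    back (inj₂ x) Tx = ∈-++⁺ʳ (map inj₁ L) (∈-map⁺ inj₂ (from (memM x) Tx))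

  length-cartesianProduct : (xs : List V) (ys : List W) →
                            length (cartesianProduct xs ys) ≡ length xs * length ys
  length-cartesianProduct [] ys = refl
  length-cartesianProduct (x ∷ xs) ys =
    trans (length-++ (map (x ,_) ys)) (cong₂ _+_ (length-map (x ,_) ys) (length-cartesianProduct xs ys))

count-all : ∀ n → HasCount {Fin n} (λ _ → ⊤) n
count-all n = allFin n , Uniqueₚ.allFin⁺ n , length-tabulate {n = n} id , λ w → mk⇔ (λ _ → tt) (λ _ → ∈-allFin w)

count-proj₁ : {V : Set} {T : V → Set} {a : ℕ} (b : ℕ) →
              HasCount T a → HasCount {V × Fin b} (T ∘ proj₁) (a * b)
count-proj₁ b (L , uniqueL , refl , memL) =
  cartesianProduct L (allFin b) , Uniqueₚ.cartesianProduct⁺ uniqueL (Uniqueₚ.allFin⁺ b) ,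
  trans (length-cartesianProduct L (allFin b)) (cong (length L *_) (length-tabulate {n = b} id)) ,
  λ (x , j) → mk⇔ (to (memL x) ∘ proj₁ ∘ ∈-cartesianProduct⁻ L (allFin b))
                   (λ Tx → ∈-cartesianProduct⁺ (from (memL x) Tx) (∈-allFin j))

count-filter : ∀ {n} {T : Fin n → Set} (T? : ∀ w → Dec (T w)) → HasCount T (length (filter T? (allFin n)))
count-filter {n} T? = filter T? (allFin n) , Uniqueₚ.filter⁺ T? (Uniqueₚ.allFin⁺ n) , refl ,
  λ w → mk⇔ (proj₂ ∘ ∈-filter⁻ T? {xs = allFin n}) (∈-filter⁺ T? (∈-allFin w))

ind : Bool → ℕ
ind true  = 1
ind false = 0

ind-mono : ∀ {b c} → (b ≡ true → c ≡ true) → ind b ≤ ind c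
ind-mono {false} _ = z≤n
ind-mono {true} {c} b⇒c rewrite b⇒c refl = ≤-refl

≡-from-⇔ : ∀ {b c} → (b ≡ true → c ≡ true) → (c ≡ true → b ≡ true) → b ≡ c
≡-from-⇔ {false} {false} _ _ = refl
≡-from-⇔ {false} {true}  _ g = g refl
≡-from-⇔ {true}  {c}     f _ = ≡sym (f refl)

does-sound : {A : Set} (d : Dec A) → does d ≡ true → A
does-sound (yes a) _ = a

sum-mono : ∀ {n} {f g : Fin n → ℕ} → (∀ i → f i ≤ g i) → sum f ≤ sum g
sum-mono {zero}  _   = z≤n
sum-mono {suc n} f≤g = +-mono-≤ (f≤g zero) (sum-mono (f≤g ∘ suc))

sum-const : ∀ n c → ∑[ i < n ] c ≡ n * c
sum-const zero    c = refl
sum-const (suc n) c = cong (c +_) (sum-const n c)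

sum-single : ∀ {n} (x : Fin n) → ∑[ w < n ] ind (does (w ≟ x)) ≡ 1
sum-single {suc n} zero    = cong suc (trans (sum-const n 0) (*-zeroʳ n))
sum-single {suc n} (suc x) = sum-single x

sum-member : ∀ {n} {L : List (Fin n)} → Unique L → ∑[ w < n ] ind (does (mem? _≟_ w L)) ≡ length L
sum-member {n} {[]} _ = trans (sum-const n 0) (*-zeroʳ n)
sum-member {n} {x ∷ L} (x∉L ∷ unique) = begin
  ∑[ w < n ] ind (does (mem? _≟_ w (x ∷ L)))                        ≡⟨ sum-cong-≗ pointwise ⟩
  ∑[ w < n ] (ind (does (w ≟ x)) + ind (does (mem? _≟_ w L)))       ≡⟨ ∑-distrib-+ (λ w → ind (does (w ≟ x))) _ ⟩
  ∑[ w < n ] ind (does (w ≟ x)) + ∑[ w < n ] ind (does (mem? _≟_ w L)) ≡⟨ cong₂ _+_ (sum-single x) (sum-member unique) ⟩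
  suc (length L)                                                    ∎
  where
  open ≡-Reasoning
  pointwise : ∀ w → ind (does (mem? _≟_ w (x ∷ L))) ≡ ind (does (w ≟ x)) + ind (does (mem? _≟_ w L))
  pointwise w with w ≟ x
  ... | no  _ = refl
  ... | yes refl with mem? _≟_ x L
  ...   | no  _   = refl
  ...   | yes x∈L = ⊥-elim (All.lookup x∉L x∈L refl)

-- Degrees in `RegularOn` are witnessed by lists; the double counting arguments need sums, whose
-- order can be interchanged.
count→sum : ∀ {n k} {b : Fin n → Bool} → HasCount (λ w → b w ≡ true) k → ∑[ w < n ] ind (b w) ≡ k
count→sum {b = b} (L , unique , len , mem) = trans (sum-cong-≗ (λ w → cong ind (≡-from-⇔
  (λ bw → dec-true (mem? _≟_ w L) (from (mem w) bw))
  (λ w∈ → to (mem w) (does-sound (mem? _≟_ w L) w∈))))) (trans (sum-member unique) len)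

length≤sum : ∀ {n} {b : Fin n → Bool} {L : List (Fin n)} → Unique L → (∀ w → w ∈ L → b w ≡ true) →
             length L ≤ ∑[ w < n ] ind (b w)
length≤sum {L = L} unique L⊆b = subst (_≤ _) (sum-member unique)
  (sum-mono (λ w → ind-mono (λ w∈ → L⊆b w (does-sound (mem? _≟_ w L) w∈))))

length-filter-tabulate : ∀ {n} {V : Set} {T : V → Set} (T? : ∀ w → Dec (T w)) (f : Fin n → V) →
                         length (filter T? (tabulate f)) ≡ ∑[ i < n ] ind (does (T? (f i)))
length-filter-tabulate {zero}  T? f = refl
length-filter-tabulate {suc n} T? f with T? (f zero)
... | yes _ = cong suc (length-filter-tabulate T? (f ∘ suc))
... | no  _ = length-filter-tabulate T? (f ∘ suc)

-- Walks and eccentricities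

least : {P : ℕ → Set} → (∀ m → Dec (P m)) → ∀ m → P m → ∃[ d ] (P d × (∀ j → P j → d ≤ j))
least P? zero    p = 0 , p , λ _ _ → z≤n
least P? (suc m) p with P? 0
... | yes p₀ = 0 , p₀ , λ _ _ → z≤n
... | no ¬p₀ with least (P? ∘ suc) m p
...   | d , pd , minimal = suc d , pd , λ { zero p₀ → ⊥-elim (¬p₀ p₀) ; (suc j) pj → s≤s (minimal j pj) }

argmax : ∀ {n} (f : Fin (suc n) → ℕ) → ∃[ i ] (∀ j → f j ≤ f i)
argmax {zero}  f = zero , λ { zero → ≤-refl }
argmax {suc n} f with argmax (f ∘ suc)
... | i , max with ≤-total (f zero) (f (suc i))
...   | inj₁ f₀≤ = suc i , λ { zero → f₀≤ ; (suc j) → max j }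
...   | inj₂ ≤f₀ = zero  , λ { zero → ≤-refl ; (suc j) → ≤-trans (max j) ≤f₀ }

module _ {n : ℕ} (G : Graph n) where

  walk-start : ∀ {S u v m} → WalkIn G S u v m → S u
  walk-start (here s)     = s
  walk-start (step s _ _) = s

  walk-map : ∀ {S T : Fin n → Set} {u v m} → (∀ {x} → S x → T x) → WalkIn G S u v m → WalkIn G T u v m
  walk-map f (here s)     = here (f s)
  walk-map f (step s e w) = step (f s) e (walk-map f w)

  walk-trans : ∀ {S u v w l m} → WalkIn G S u v l → WalkIn G S v w m → WalkIn G S u w (l + m)
  walk-trans (here _)     q = q
  walk-trans (step s e p) q = step s e (walk-trans p q)

  walk-snoc : ∀ {S u v w m} → WalkIn G S u v m → adj G v w ≡ true → S w → WalkIn G S u w (suc m)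
  walk-snoc (here s)     f t = step s f (here t)
  walk-snoc (step s e p) f t = step s e (walk-snoc p f t)

  walk-sym : ∀ {S u v m} → WalkIn G S u v m → WalkIn G S v u m
  walk-sym (here s)             = here s
  walk-sym (step {u} {w} s e p) = walk-snoc (walk-sym p) (trans (Graph.sym G w u) e) s

  walkIn? : ∀ {S} → (∀ v → Dec (S v)) → ∀ m u v → Dec (WalkIn G S u v m)
  walkIn? S? zero u v =
    map′ (λ { (refl , s) → here s }) (λ { (here s) → refl , s }) (u ≟ v ×-dec S? u)
  walkIn? S? (suc m) u v =
    map′ (λ (s , w , e , p) → step s e p) (λ { (step s e p) → s , _ , e , p })
         (S? u ×-dec any? (λ w → (adj G u w Boolₚ.≟ true) ×-dec walkIn? S? m w v))

  walk⇒dist : ∀ {u v m} → Walk G u v m → ∃[ d ] Dist G u v d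
  walk⇒dist {u} {v} {m} p with least (λ m → walkIn? (λ _ → yes tt) m u v) m p
  ... | d , q , minimal = d , q , minimal

  dist-unique : ∀ {u v d d'} → Dist G u v d → Dist G u v d' → d ≡ d'
  dist-unique (p , min) (p' , min') = ≤-antisym (min _ p') (min' _ p)

  ecc-bound : ∀ {v e u d} → Ecc G v e → Dist G v u d → d ≤ e
  ecc-bound (all , _) Dd with all _
  ... | d' , Dd' , d'≤e = subst (_≤ _) (dist-unique Dd' Dd) d'≤e

  ecc-unique : ∀ {v e e'} → Ecc G v e → Ecc G v e' → e ≡ e'
  ecc-unique E@(_ , u , D) E'@(_ , u' , D') = ≤-antisym (ecc-bound E' D) (ecc-bound E D')

  -- Any walks serve as upper bounds and one far vertex as the lower bound, so no other distance has
  -- to be determined exactly.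
  ecc-intro : ∀ {v e} → (∀ u → ∃[ m ] (Walk G v u m × m ≤ e)) →
              ∃[ u ] (∀ m → Walk G v u m → e ≤ m) → Ecc G v e
  ecc-intro {v} {e} near (u , far) = (λ w → upper w (near w)) , u , exact (near u)
    where
    upper : ∀ w → ∃[ m ] (Walk G v w m × m ≤ e) → ∃[ d ] (Dist G v w d × d ≤ e)
    upper w (m , p , m≤e) with walk⇒dist p
    ... | d , D@(_ , minimal) = d , D , ≤-trans (minimal m p) m≤e
    exact : ∃[ m ] (Walk G v u m × m ≤ e) → Dist G v u e
    exact (m , p , m≤e) = subst (Walk G v u) (≤-antisym m≤e (far m p)) p , far

  rad-unique : ∀ {r r'} → Rad G r → Rad G r' → r ≡ r'
  rad-unique ((v , E) , min) ((v' , E') , min') = ≤-antisym (min v' _ E') (min' v _ E)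

  diam-unique : ∀ {D D'} → Diam G D → Diam G D' → D ≡ D'
  diam-unique ((v , E) , max) ((v' , E') , max') = ≤-antisym (max' v _ E) (max v' _ E')

  ecc-step : ∀ {u w e f} → adj G u w ≡ true → Ecc G u e → Ecc G w f → e ≤ suc f
  ecc-step uw (_ , t , D) (near , _) with near t
  ... | d , (p , _) , d≤f = ≤-trans (proj₂ D _ (step tt uw p)) (s≤s d≤f)

ecc-exists : ∀ {n} (G : Graph n) → Connected G → ∀ v → ∃[ e ] Ecc G v e
ecc-exists {suc n} G (_ , connected) v = proj₁ (dist far) , (λ u → proj₁ (dist u) , proj₂ (dist u) , max u) , far , proj₂ (dist far)
  where
  dist : ∀ u → ∃[ d ] Dist G v u d
  dist u = walk⇒dist G (proj₂ (connected v u tt tt))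
  far = proj₁ (argmax (proj₁ ∘ dist))
  max = proj₂ (argmax (proj₁ ∘ dist))

-- The order of the periphery

levelDist : Fin 8 → Fin 8 → ℕ
levelDist i j = let d = ∣ toℕ i - toℕ j ∣ in d ⊓ (8 ∸ d)

-- Besides the true antipodes these are the pairs at cyclic distance three: together, exactly the
-- positions with disjoint closed neighbourhoods in the 8-cycle.
antipodalPairs : List (Fin 8 × Fin 8)
antipodalPairs = filter (λ (i , j) → 3 ≤? levelDist i j ×-dec toℕ i <? toℕ j) (cartesianProduct (allFin 8) (allFin 8))

Separated : Vec Bool 8 → Set
Separated b = All (λ (i , j) → ¬ (Vec.lookup b i ≡ true × Vec.lookup b j ≡ true)) antipodalPairs

allVec? : ∀ {n} {P : Vec Bool n → Set} → (∀ b → Dec (P b)) → Dec (∀ b → P b)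
allVec? {zero}  P? = map′ (λ { p [] → p }) (λ p → p []) (P? [])
allVec? {suc n} P? =
  map′ (λ { (p , q) (true ∷ b) → p b ; (p , q) (false ∷ b) → q b })
       (λ p → (λ b → p (true ∷ b)) , (λ b → p (false ∷ b)))
       (allVec? (λ b → P? (true ∷ b)) ×-dec allVec? (λ b → P? (false ∷ b)))

-- A subset of the 8-cycle of diameter at most 2 has at most 3 elements.
separated-bound : ∀ b → Separated b → ∑[ i < 8 ] ind (Vec.lookup b i) ≤ 3
separated-bound = from-yes (allVec? λ b →
  All.all? (λ (i , j) → ¬? ((Vec.lookup b i Boolₚ.≟ true) ×-dec (Vec.lookup b j Boolₚ.≟ true))) antipodalPairs
  →-dec (∑[ i < 8 ] ind (Vec.lookup b i) ≤? 3))

∧-true : ∀ {b c} → b ∧ c ≡ true → b ≡ true × c ≡ true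
∧-true {true} {true} _ = refl , refl

module _ {n : ℕ} where

  closed : Graph n → Fin n → Fin n → Bool
  closed G s z = does (z ≟ s) ∨ adj G s z

  ∑-closed : ∀ {k} (G : Graph n) {S : Fin n → Set} (S? : ∀ v → Dec (S v)) → RegularOn G k S →
             ∀ s → S s → ∑[ z < n ] ind (does (S? z) ∧ closed G s z) ≡ suc k
  ∑-closed {k} G {S} S? regular s Ss with regular s Ss
  ... | L , unique , len , mem = count→sum (s ∷ L , (s∉L ∷ unique) , cong suc len , λ w → mk⇔ (forth w) (back w))
    where
    s∉L : All (s ≢_) L
    s∉L = All.tabulate λ { s∈L refl → case trans (≡sym (irrefl G s)) (proj₂ (to (mem s) s∈L)) of λ () }
    forth : ∀ w → w ∈ s ∷ L → does (S? w) ∧ closed G s w ≡ true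
    forth w (Any.here refl) rewrite dec-true (S? s) Ss | dec-true (s ≟ s) refl = refl
    forth w (Any.there w∈L) with to (mem w) w∈L
    ... | Sw , sw rewrite dec-true (S? w) Sw | sw = Boolₚ.∨-zeroʳ _
    back : ∀ w → does (S? w) ∧ closed G s w ≡ true → w ∈ s ∷ L
    back w eq with S? w | w ≟ s
    ... | yes _  | yes w≡s = Any.here w≡s
    ... | yes Sw | no  _   = Any.there (from (mem w) (Sw , eq))

module Packing {n k : ℕ} (G : Graph n) {S : Fin n → Set} (S? : ∀ v → Dec (S v))
  (regular : RegularOn G k S) (connected : ConnectedOn G S)
  (antipode : ∀ v → S v → ∃[ w ] (S w × (∀ m → WalkIn G S v w m → 4 ≤ m))) where

  Reach : ℕ → Fin n → Fin n → Set
  Reach b u v = ∃[ m ] (m ≤ b × WalkIn G S u v m)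

  reach-trans : ∀ {a b u v w} → Reach a u v → Reach b v w → Reach (a + b) u w
  reach-trans (_ , p≤ , p) (_ , q≤ , q) = _ , +-mono-≤ p≤ q≤ , walk-trans G p q

  Far : Fin n → Fin n → Set
  Far u v = ¬ Reach 3 u v

  far-antipode : ∀ v → S v → ∃[ w ] (S w × Far v w)
  far-antipode v Sv with antipode v Sv
  ... | w , Sw , far = w , Sw , λ (m , m≤3 , p) → <⇒≱ (far m p) m≤3

  reach? : ∀ u v → Dec (Reach 3 u v)
  reach? u v = map′ (λ (m , m<4 , p) → m , s≤s⁻¹ m<4 , p) (λ (m , m≤3 , p) → m , s≤s m≤3 , p)
                    (anyUpTo? (λ m → walkIn? G S? m u v) 4)

  record Geodesic : Set where
    field
      x₀ x₁ x₂ x₃ x₄ : Fin n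
      S₀ : S x₀
      S₁ : S x₁
      S₂ : S x₂
      S₃ : S x₃
      S₄ : S x₄
      e₀ : adj G x₀ x₁ ≡ true
      e₁ : adj G x₁ x₂ ≡ true
      e₂ : adj G x₂ x₃ ≡ true
      e₃ : adj G x₃ x₄ ≡ true
      far : Far x₀ x₄

  -- A walk from inside the ball of radius 3 around `u` to a target outside it has an edge leaving
  -- the ball; the end of this edge is at distance exactly four.
  geodesic-along : ∀ {u v t m} → Reach 3 u v → WalkIn G S v t m → Far u t → Geodesic
  geodesic-along uv (here _) far = ⊥-elim (far uv)
  geodesic-along {u} uv@(l , l≤3 , p) (step {w = w} Sv vw q) far with reach? u w
  ... | yes uw = geodesic-along uw q far
  ... | no ¬uw = extend l l≤3 p
    where
    Sw = walk-start G q
    extend : ∀ l → l ≤ 3 → WalkIn G S u _ l → Geodesic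
    -- A walk to the last vertex in the ball with fewer than three edges would put `w` into the ball
    -- too, so only length three remains.
    extend 0 _ p = ⊥-elim (¬uw (1 , s≤s z≤n , walk-snoc G p vw Sw))
    extend 1 _ p = ⊥-elim (¬uw (2 , s≤s (s≤s z≤n) , walk-snoc G p vw Sw))
    extend 2 _ p = ⊥-elim (¬uw (3 , ≤-refl , walk-snoc G p vw Sw))
    extend 3 _ (step s₀ e₀ (step s₁ e₁ (step s₂ e₂ (here s₃)))) = record
      { S₀ = s₀ ; S₁ = s₁ ; S₂ = s₂ ; S₃ = s₃ ; S₄ = Sw ; e₀ = e₀ ; e₁ = e₁ ; e₂ = e₂ ; e₃ = vw ; far = ¬uw }
    extend (suc (suc (suc (suc _)))) (s≤s (s≤s (s≤s ()))) _

  N : Fin n → Fin n → Bool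
  N s z = does (S? z) ∧ closed G s z

  reach-closed : ∀ {s z} → S s → N s z ≡ true → Reach 1 s z
  reach-closed {s} {z} Ss eq with S? z | z ≟ s
  ... | yes _  | yes refl = 0 , z≤n , here Ss
  ... | yes Sz | no  _    = 1 , ≤-refl , step Ss eq (here Sz)

  reach-sym : ∀ {b u v} → Reach b u v → Reach b v u
  reach-sym (m , m≤b , p) = m , m≤b , walk-sym G p

  common : ∀ {s t z} → S s → S t → N s z ≡ true → N t z ≡ true → Reach 2 s t
  common Ss St p q = reach-trans (reach-closed Ss p) (reach-sym (reach-closed St q))

  edge : ∀ {u v} → S u → S v → adj G u v ≡ true → Reach 1 u v
  edge Su Sv uv = 1 , ≤-refl , step Su uv (here Sv)

  loop : ∀ {u} → S u → Reach 1 u u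
  loop Su = 0 , z≤n , here Su

  -- Four consecutive vertices of a geodesic and antipodes of them behave like an isometric 8-cycle;
  -- taking x₄ as the antipode of x₀ keeps the first and the last antipode apart.
  module Octagon (g : Geodesic) where
    open Geodesic g

    y₁ = proj₁ (far-antipode x₁ S₁)
    y₂ = proj₁ (far-antipode x₂ S₂)
    y₃ = proj₁ (far-antipode x₃ S₃)

    T₁ = proj₁ (proj₂ (far-antipode x₁ S₁))
    T₂ = proj₁ (proj₂ (far-antipode x₂ S₂))
    T₃ = proj₁ (proj₂ (far-antipode x₃ S₃))

    far₁ = proj₂ (proj₂ (far-antipode x₁ S₁))
    far₂ = proj₂ (proj₂ (far-antipode x₂ S₂))
    far₃ = proj₂ (proj₂ (far-antipode x₃ S₃))

    corners : Vec (Fin n) 8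
    corners = x₀ ∷ x₁ ∷ x₂ ∷ x₃ ∷ x₄ ∷ y₁ ∷ y₂ ∷ y₃ ∷ []

    corner-S : ∀ i → S (Vec.lookup corners i)
    corner-S 0F = S₀
    corner-S 1F = S₁
    corner-S 2F = S₂
    corner-S 3F = S₃
    corner-S 4F = S₄
    corner-S 5F = T₁
    corner-S 6F = T₂
    corner-S 7F = T₃

    x₀x₁ = edge S₀ S₁ e₀
    x₁x₂ = edge S₁ S₂ e₁
    x₂x₃ = edge S₂ S₃ e₂
    x₃x₄ = edge S₃ S₄ e₃

    separated : ∀ z → Separated (Vec.map (λ s → N s z) corners)
    separated z =
        -- A common closed neighbour puts two corners at distance at most 2. At most one further
        -- edge turns this into a walk of length at most 3 between the ends of the geodesic or
        -- between a vertex and its antipode. The entries follow the order of `antipodalPairs`.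
        (λ (p , q) → far (reach-trans (common S₀ S₃ p q) x₃x₄))
      ∷ (λ (p , q) → far (reach-trans (loop S₀) (common S₀ S₄ p q)))
      ∷ (λ (p , q) → far₁ (reach-trans (reach-sym x₀x₁) (common S₀ T₁ p q)))
      ∷ (λ (p , q) → far (reach-trans x₀x₁ (common S₁ S₄ p q)))
      ∷ (λ (p , q) → far₁ (reach-trans (loop S₁) (common S₁ T₁ p q)))
      ∷ (λ (p , q) → far₂ (reach-trans (reach-sym x₁x₂) (common S₁ T₂ p q)))
      ∷ (λ (p , q) → far₁ (reach-trans x₁x₂ (common S₂ T₁ p q)))
      ∷ (λ (p , q) → far₂ (reach-trans (loop S₂) (common S₂ T₂ p q)))
      ∷ (λ (p , q) → far₃ (reach-trans (reach-sym x₂x₃) (common S₂ T₃ p q)))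
      ∷ (λ (p , q) → far₂ (reach-trans x₂x₃ (common S₃ T₂ p q)))
      ∷ (λ (p , q) → far₃ (reach-trans (loop S₃) (common S₃ T₃ p q)))
      ∷ (λ (p , q) → far₃ (reach-trans x₃x₄ (common S₄ T₃ p q)))
      ∷ []

    covered : ∀ z → ∑[ i < 8 ] ind (N (Vec.lookup corners i) z) ≤ 3 * ind (does (S? z))
    covered z = restrict (does (S? z)) (λ s → closed G s z) (separated-bound (Vec.map (λ s → N s z) corners) (separated z))
      where
      restrict : ∀ b (c : Fin n → Bool) → ∑[ i < 8 ] ind (Vec.lookup (Vec.map (λ s → b ∧ c s) corners) i) ≤ 3 →
                 ∑[ i < 8 ] ind (b ∧ c (Vec.lookup corners i)) ≤ 3 * ind b
      restrict true  c bound = bound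
      restrict false c _     = z≤n

    -- Double counting of pairs of a corner and a member of its closed neighbourhood: each corner
    -- contributes `k + 1`, each vertex of `S` at most three.
    octagon-bound : 8 * suc k ≤ 3 * ∑[ z < n ] ind (does (S? z))
    octagon-bound = begin
      8 * suc k                                                ≡⟨ sum-const 8 (suc k) ⟨
      ∑[ i < 8 ] suc k                                         ≡⟨ sum-cong-≗ {8} (λ i → ∑-closed G S? regular (Vec.lookup corners i) (corner-S i)) ⟨
      ∑[ i < 8 ] ∑[ z < n ] ind (N (Vec.lookup corners i) z)   ≡⟨ ∑-comm {8} {n} (λ i z → ind (N (Vec.lookup corners i) z)) ⟩
      ∑[ z < n ] ∑[ i < 8 ] ind (N (Vec.lookup corners i) z)   ≤⟨ sum-mono covered ⟩
      ∑[ z < n ] (3 * ind (does (S? z)))                       ≡⟨ *-distribˡ-sum 3 (λ z → ind (does (S? z))) ⟨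
      3 * ∑[ z < n ] ind (does (S? z))                         ∎
      where open ≤-Reasoning

  geodesic : Geodesic
  geodesic =
    let (u , Su) , walks = connected
        t , St , far = far-antipode u Su
    in geodesic-along (0 , z≤n , here Su) (proj₂ (walks u t Su St)) far

  order-bound : 8 * suc k ≤ 3 * ∑[ z < n ] ind (does (S? z))
  order-bound = Octagon.octagon-bound geodesic

-- Necessity of the order condition

-- Removing vertex `zero` takes away its row and its column, which have the same sum `R` by
-- symmetry.
handshake : ∀ {n} (b : Fin n → Fin n → Bool) → (∀ u v → b u v ≡ b v u) → (∀ v → b v v ≡ false) →
            2 ∣ ∑[ u < n ] ∑[ v < n ] ind (b u v)
handshake {zero}  b symmetric irreflexive = 2 ∣0
handshake {suc n} b symmetric irreflexive = subst (2 ∣_) (≡sym eq)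
  (∣m∣n⇒∣m+n (divides-refl R) (handshake (λ u v → b (suc u) (suc v)) (λ u v → symmetric (suc u) (suc v)) (irreflexive ∘ suc)))
  where
  open ≡-Reasoning
  R = ∑[ v < n ] ind (b zero (suc v))
  rest = ∑[ u < n ] ∑[ v < n ] ind (b (suc u) (suc v))
  eq : ∑[ u < suc n ] ∑[ v < suc n ] ind (b u v) ≡ R * 2 + rest
  eq = begin
    (ind (b zero zero) + R) + ∑[ u < n ] (ind (b (suc u) zero) + ∑[ v < n ] ind (b (suc u) (suc v)))
      ≡⟨ cong₂ _+_ (cong (λ x → ind x + R) (irreflexive zero)) (∑-distrib-+ (λ u → ind (b (suc u) zero)) _) ⟩
    R + (∑[ u < n ] ind (b (suc u) zero) + rest)
      ≡⟨ cong (λ x → R + (x + rest)) (sum-cong-≗ (λ u → cong ind (symmetric (suc u) zero))) ⟩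
    R + (R + rest)
      ≡⟨ +-assoc R R rest ⟨
    R + R + rest
      ≡⟨ cong (_+ rest) (trans (cong (R +_) (≡sym (+-identityʳ R))) (*-comm 2 R)) ⟩
    R * 2 + rest ∎

module _ {n k : ℕ} (G : Graph n) {S : Fin n → Set} (S? : ∀ v → Dec (S v)) (regular : RegularOn G k S) where

  private
    #S = ∑[ z < n ] ind (does (S? z))

  ∑-induced : ∀ u → ∑[ v < n ] ind (does (S? u) ∧ (does (S? v) ∧ adj G u v)) ≡ ind (does (S? u)) * k
  ∑-induced u with S? u
  ... | no _ = trans (sum-const n 0) (*-zeroʳ n)
  ... | yes Su = trans (count→sum (count-cong (λ w → mk⇔
      (λ (Sw , uw) → cong₂ _∧_ (dec-true (S? w) Sw) uw)
      (λ eq → does-sound (S? w) (proj₁ (∧-true eq)) , proj₂ (∧-true eq))) (regular u Su))) (≡sym (*-identityˡ k))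

  degree-sum-even : 2 ∣ #S * k
  degree-sum-even = subst (2 ∣_) (trans (sum-cong-≗ ∑-induced) (≡sym (*-distribʳ-sum k (λ u → ind (does (S? u))))))
    (handshake (λ u v → does (S? u) ∧ (does (S? v) ∧ adj G u v)) symmetric irreflexive)
    where
    irreflexive : ∀ v → does (S? v) ∧ (does (S? v) ∧ adj G v v) ≡ false
    irreflexive v rewrite irrefl G v | Boolₚ.∧-zeroʳ (does (S? v)) = Boolₚ.∧-zeroʳ (does (S? v))
    symmetric : ∀ u v → does (S? u) ∧ (does (S? v) ∧ adj G u v) ≡ does (S? v) ∧ (does (S? u) ∧ adj G v u)
    symmetric u v rewrite Graph.sym G v u = begin
      a ∧ (b ∧ c) ≡⟨ Boolₚ.∧-assoc a b c ⟨
      (a ∧ b) ∧ c ≡⟨ cong (_∧ c) (Boolₚ.∧-comm a b) ⟩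
      (b ∧ a) ∧ c ≡⟨ Boolₚ.∧-assoc b a c ⟩
      b ∧ (a ∧ c) ∎
      where
      open ≡-Reasoning
      a = does (S? u)
      b = does (S? v)
      c = adj G u v

  even-order : ¬ 2 ∣ k → 2 ∣ #S
  even-order ¬2∣k = [ id , ⊥-elim ∘ ¬2∣k ]′ (euclidsLemma #S k (from-yes (prime? 2)) degree-sum-even)

  suc-degree≤order : ∀ v → S v → suc k ≤ #S
  suc-degree≤order v Sv = subst (_≤ #S) (∑-closed G S? regular v Sv)
    (sum-mono (λ z → ind-mono (λ eq → proj₁ (∧-true {does (S? z)} eq))))

  -- Two distinct non-adjacent vertices and the `k` neighbours of one of them already make `k + 2`
  -- vertices.
  order-or-clique : suc (suc k) ≤ #S ⊎ (∀ u v → S u → S v → u ≡ v ⊎ adj G u v ≡ true)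
  order-or-clique with suc (suc k) ≤? #S
  ... | yes big  = inj₁ big
  ... | no small = inj₂ clique
    where
    clique : ∀ u v → S u → S v → u ≡ v ⊎ adj G u v ≡ true
    clique u v Su Sv with u ≟ v | adj G u v in uv
    ... | yes u≡v | _    = inj₁ u≡v
    ... | no _   | true  = inj₂ refl
    ... | no u≢v | false with regular u Su
    ...   | L , unique , len , mem = ⊥-elim (small (subst (λ l → suc (suc l) ≤ #S) len
            (length≤sum {L = u ∷ v ∷ L} ((u≢v ∷ u∉L) ∷ v∉L ∷ unique) inside)))
      where
      u∉L : All (u ≢_) L
      u∉L = All.tabulate λ { u∈L refl → case trans (≡sym (irrefl G u)) (proj₂ (to (mem u) u∈L)) of λ () }
      v∉L : All (v ≢_) L
      v∉L = All.tabulate λ { v∈L refl → case trans (≡sym uv) (proj₂ (to (mem v) v∈L)) of λ () }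
      inside : ∀ w → w ∈ u ∷ v ∷ L → does (S? w) ≡ true
      inside w (Any.here refl)              = dec-true (S? w) Su
      inside w (Any.there (Any.here refl))  = dec-true (S? w) Sv
      inside w (Any.there (Any.there w∈L)) = dec-true (S? w) (proj₁ (to (mem w) w∈L))

ind-partition : {A B C : Set} (a? : Dec A) (b? : Dec B) (c? : Dec C) →
                (A → ¬ B) → (B → ¬ C) → (A → ¬ C) → (¬ A → ¬ B → ¬ ¬ C) →
                ind (does a?) + (ind (does b?) + ind (does c?)) ≡ 1
ind-partition (yes a) (yes b) _       ¬ab _   _   _   = ⊥-elim (¬ab a b)
ind-partition (yes a) (no _)  (yes c) _   _   ¬ac _   = ⊥-elim (¬ac a c)
ind-partition (yes _) (no _)  (no _)  _   _   _   _   = refl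
ind-partition (no _)  (yes b) (yes c) _   ¬bc _   _   = ⊥-elim (¬bc b c)
ind-partition (no _)  (yes _) (no _)  _   _   _   _   = refl
ind-partition (no _)  (no _)  (yes _) _   _   _   _   = refl
ind-partition (no ¬a) (no ¬b) (no ¬c) _   _   _   one = ⊥-elim (one ¬a ¬b ¬c)

module Necessity {n k : ℕ} (G : Graph n) (connected : Connected G) (regular : MetricConnectedRegular G k) where

  connected-C = proj₁ (proj₁ regular)
  regular-C   = proj₂ (proj₁ regular)
  connected-A = proj₁ (proj₁ (proj₂ regular))
  regular-A   = proj₂ (proj₁ (proj₂ regular))
  connected-P = proj₁ (proj₂ (proj₂ regular))
  regular-P   = proj₂ (proj₂ (proj₂ regular))

  ecc : Fin n → ℕ
  ecc v = proj₁ (ecc-exists G connected v)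

  ecc-is : ∀ v → Ecc G v (ecc v)
  ecc-is v = proj₂ (ecc-exists G connected v)

  r = proj₁ (proj₂ (proj₁ connected-C))
  D = proj₁ (proj₂ (proj₁ connected-P))

  rad : Rad G r
  rad = proj₁ (proj₂ (proj₂ (proj₁ connected-C)))

  diam : Diam G D
  diam = proj₁ (proj₂ (proj₂ (proj₁ connected-P)))

  r≤ecc : ∀ v → r ≤ ecc v
  r≤ecc v = proj₂ rad v (ecc v) (ecc-is v)

  ecc≤D : ∀ v → ecc v ≤ D
  ecc≤D v = proj₂ diam v (ecc v) (ecc-is v)

  center⇔ : ∀ v → (ecc v ≡ r) ⇔ Center G v
  center⇔ v = mk⇔ (λ { eq → r , rad , subst (Ecc G v) eq (ecc-is v) })
                  (λ (_ , rad' , E) → trans (ecc-unique G (ecc-is v) E) (rad-unique G rad' rad))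

  periphery⇔ : ∀ v → (ecc v ≡ D) ⇔ Periphery G v
  periphery⇔ v = mk⇔ (λ { eq → D , diam , subst (Ecc G v) eq (ecc-is v) })
                     (λ (_ , diam' , E) → trans (ecc-unique G (ecc-is v) E) (diam-unique G diam' diam))

  annulus⇔ : ∀ v → (r < ecc v × ecc v < D) ⇔ Annulus G v
  annulus⇔ v = mk⇔ (λ (r<e , e<D) → r , D , ecc v , rad , diam , ecc-is v , r<e , e<D) back
    where
    back : Annulus G v → r < ecc v × ecc v < D
    back (_ , _ , _ , rad' , diam' , E , r<e , e<D)
      rewrite rad-unique G rad' rad | diam-unique G diam' diam | ecc-unique G E (ecc-is v) = r<e , e<D

  C? : ∀ v → Dec (Center G v)
  C? v = map′ (to (center⇔ v)) (from (center⇔ v)) (ecc v ℕₚ.≟ r)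

  A? : ∀ v → Dec (Annulus G v)
  A? v = map′ (to (annulus⇔ v)) (from (annulus⇔ v)) (r <? ecc v ×-dec ecc v <? D)

  P? : ∀ v → Dec (Periphery G v)
  P? v = map′ (to (periphery⇔ v)) (from (periphery⇔ v)) (ecc v ℕₚ.≟ D)

  #C = ∑[ v < n ] ind (does (C? v))
  #A = ∑[ v < n ] ind (does (A? v))
  #P = ∑[ v < n ] ind (does (P? v))

  r+2≤D : suc (suc r) ≤ D
  r+2≤D with connected-A
  ... | (a , Aa) , _ with from (annulus⇔ a) Aa
  ...   | r<e , e<D = ≤-trans (s≤s r<e) e<D

  partition : ∀ v → ind (does (C? v)) + (ind (does (A? v)) + ind (does (P? v))) ≡ 1
  partition v = ind-partition (C? v) (A? v) (P? v)
    (λ Cv Av → <⇒≢ (proj₁ (from (annulus⇔ v) Av)) (≡sym (from (center⇔ v) Cv)))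
    (λ Av Pv → <⇒≢ (proj₂ (from (annulus⇔ v) Av)) (from (periphery⇔ v) Pv))
    (λ Cv Pv → <⇒≢ (≤-trans (n≤1+n _) r+2≤D) (trans (≡sym (from (center⇔ v) Cv)) (from (periphery⇔ v) Pv)))
    (λ ¬Cv ¬Av ¬Pv → ¬Av (to (annulus⇔ v)
      (≤∧≢⇒< (r≤ecc v) (¬Cv ∘ to (center⇔ v) ∘ ≡sym) , ≤∧≢⇒< (ecc≤D v) (¬Pv ∘ to (periphery⇔ v)))))

  order : #C + (#A + #P) ≡ n
  order = begin
    #C + (#A + #P)                                                               ≡⟨ cong (#C +_) (∑-distrib-+ (λ v → ind (does (A? v))) _) ⟨
    #C + ∑[ v < n ] (ind (does (A? v)) + ind (does (P? v)))                      ≡⟨ ∑-distrib-+ (λ v → ind (does (C? v))) _ ⟨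
    ∑[ v < n ] (ind (does (C? v)) + (ind (does (A? v)) + ind (does (P? v))))     ≡⟨ sum-cong-≗ partition ⟩
    ∑[ v < n ] 1                                                                 ≡⟨ trans (sum-const n 1) (*-identityʳ n) ⟩
    n ∎
    where open ≡-Reasoning

  -- The far end of a diametral path has eccentricity at least `D` as well, so antipodes stay in the
  -- periphery.
  farthest : ∀ v → Periphery G v → ∃[ w ] (Periphery G w × Dist G v w D)
  farthest v Pv with subst (Ecc G v) (from (periphery⇔ v) Pv) (ecc-is v)
  ... | _ , w , p , minimal = w , to (periphery⇔ w) (≤-antisym (ecc≤D w)
      (ecc-bound G (ecc-is w) (walk-sym G p , λ m q → minimal m (walk-sym G q)))) , p , minimal

  near-center : ∀ c v → Center G c → ∃[ m ] (Walk G c v m × m ≤ r)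
  near-center c v Cc with proj₁ (subst (Ecc G c) (from (center⇔ c) Cc) (ecc-is c)) v
  ... | m , (p , _) , m≤r = m , p , m≤r

  c₀ = proj₁ (proj₁ connected-C)
  Cc₀ = proj₂ (proj₁ connected-C)
  p₀ = proj₁ (proj₁ connected-P)
  Pp₀ = proj₂ (proj₁ connected-P)

  -- A detour through a central vertex gives `D ≤ 2r`, and `r + 2 ≤ D` then forces `2 ≤ r`.
  4≤D : 4 ≤ D
  4≤D with farthest p₀ Pp₀
  ... | p' , _ , _ , minimal with near-center c₀ p₀ Cc₀ | near-center c₀ p' Cc₀
  ...   | m , w , m≤r | m' , w' , m'≤r = ≤-trans (s≤s (s≤s 2≤r)) r+2≤D
    where
    D≤2r : D ≤ r + r
    D≤2r = ≤-trans (minimal _ (walk-trans G (walk-sym G w) w')) (+-mono-≤ m≤r m'≤r)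
    2≤r : 2 ≤ r
    2≤r = +-cancelʳ-≤ r 2 r (≤-trans r+2≤D D≤2r)

  -- Walks inside the periphery are walks of `G`, so antipodes at distance `D ≥ 4` in `G` are at
  -- least as far apart in the induced subgraph, where the packing takes place.
  periphery-bound : 8 * suc k ≤ 3 * #P
  periphery-bound = Packing.order-bound G P? regular-P connected-P λ v Pv →
    let w , Pw , _ , minimal = farthest v Pv
    in w , Pw , λ m p → ≤-trans 4≤D (minimal m (walk-map G _ p))

  center-bound : suc k ≤ #C
  center-bound = suc-degree≤order G C? regular-C c₀ Cc₀

  ecc-adjacent : ∀ {u w} → adj G u w ≡ true → ecc u ≤ suc (ecc w)
  ecc-adjacent {u} {w} uw = ecc-step G uw (ecc-is u) (ecc-is w)

  -- Eccentricities of adjacent vertices differ by at most one while `r + 2 ≤ D`, so a walk leaving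
  -- the periphery cannot skip the annulus.
  leave-periphery : ∀ {u v m} → Walk G u v m → Periphery G u → Center G v →
                    ∃[ p ] ∃[ a ] (Periphery G p × Annulus G a × adj G p a ≡ true)
  leave-periphery {u} (here _) Pu Cu =
    ⊥-elim (<⇒≢ (≤-trans (n≤1+n _) r+2≤D) (trans (≡sym (from (center⇔ u) Cu)) (from (periphery⇔ u) Pu)))
  leave-periphery {u} (step {w = w} _ uw q) Pu Cv with P? w
  ... | yes Pw = leave-periphery q Pw Cv
  ... | no ¬Pw = u , w , Pu , to (annulus⇔ w) (r<e , ≤∧≢⇒< (ecc≤D w) (¬Pw ∘ to (periphery⇔ w))) , uw
    where
    r<e : r < ecc w
    r<e = s≤s⁻¹ (≤-trans r+2≤D (subst (_≤ suc (ecc w)) (from (periphery⇔ u) Pu) (ecc-adjacent uw)))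

  -- The first vertex off the center has eccentricity at most `r + 1`, hence less than `D`. The
  -- strict `l < m` records the step already spent, which is the step saved in `annulus-bound`.
  through-annulus : ∀ {u v m} → Walk G u v m → Center G u → Periphery G v →
                    ∃[ a ] ∃[ l ] (Annulus G a × Walk G a v l × l < m)
  through-annulus {u} (here _) Cu Pu =
    ⊥-elim (<⇒≢ (≤-trans (n≤1+n _) r+2≤D) (trans (≡sym (from (center⇔ u) Cu)) (from (periphery⇔ u) Pu)))
  through-annulus {u} (step {w = w} _ uw q) Cu Pv with C? w
  ... | yes Cw = let a , l , Aa , p , l<m = through-annulus q Cw Pv in a , l , Aa , p , m<n⇒m<1+n l<m
  ... | no ¬Cw = w , _ , to (annulus⇔ w) (≤∧≢⇒< (r≤ecc w) (¬Cw ∘ to (center⇔ w) ∘ ≡sym) , e<D) , q , ≤-refl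
    where
    e<D : ecc w < D
    e<D = ≤-trans (s≤s (subst (λ e → ecc w ≤ suc e) (from (center⇔ u) Cu)
            (ecc-adjacent (trans (Graph.sym G w u) uw)))) r+2≤D

  -- If the annulus were a clique, a peripheral vertex adjacent to it would have eccentricity at most r + 1:
  -- every shortest path from the center to the periphery already spends a step on reaching the annulus.
  annulus-bound : suc (suc k) ≤ #A
  annulus-bound with order-or-clique G A? regular-A
  ... | inj₁ bound = bound
  ... | inj₂ clique with leave-periphery (proj₂ (proj₂ connected p₀ c₀ tt tt)) Pp₀ Cc₀
  ...   | p , a , Pp , Aa , pa with farthest p Pp
  ...     | p' , Pp' , _ , minimal with near-center c₀ p' Cc₀
  ...       | m , w , m≤r with through-annulus w Cc₀ Pp'
  ...         | a' , l , Aa' , q , l<m with clique a a' Aa Aa'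
  ...           | inj₁ refl = ⊥-elim (<⇒≱ r+2≤D (≤-trans (minimal _ (step tt pa q))
                                (m≤n⇒m≤1+n (≤-trans l<m m≤r))))
  ...           | inj₂ aa' = ⊥-elim (<⇒≱ r+2≤D (≤-trans (minimal _ (step tt pa (step tt aa' q)))
                                (s≤s (≤-trans l<m m≤r))))

  bounds : ∃[ c ] ∃[ a ] ∃[ p ] (c + (a + p) ≡ n × suc k ≤ c × suc (suc k) ≤ a × 8 * suc k ≤ 3 * p ×
                                 (¬ 2 ∣ k → 2 ∣ c × 2 ∣ a × 2 ∣ p))
  bounds = #C , #A , #P , order , center-bound , annulus-bound , periphery-bound , λ ¬2∣k →
    even-order G C? regular-C ¬2∣k , even-order G A? regular-A ¬2∣k , even-order G P? regular-P ¬2∣k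

-- Arithmetic of the order condition

odd : ∀ {x} t → x ≡ suc (t * 2) → ¬ 2 ∣ x
odd t refl 2∣x = case trans (≡sym (n∣m⇒m%n≡0 _ 2 2∣x)) ([m+kn]%n≡m%n 1 t 2) of λ ()

even-up : ∀ {x m} t → x ≡ suc (t * 2) → 2 ∣ m → x ≤ m → suc x ≤ m
even-up t x-odd 2∣m x≤m = ≤∧≢⇒< x≤m λ { refl → odd t x-odd 2∣m }

private
  -- The last index is the case. `eq₀` shows that `k` is odd, `eq₁` divides `8(k + 1)` by 3 for
  -- `p-above`, `eq₃` and `eq₄` show that `k + 2` and the bound on `p` are odd, and `eq₂` adds the
  -- three minima.
  eq₁-₁ : ∀ s → 3 * (8 * (s * 2) + 2) + 2 ≡ 8 * (1 + (s * 2 * 3))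
  eq₁-₁ = solve-∀
  eq₂-₁ : ∀ s → (1 + (s * 2 * 3)) + (2 + s * 2 * 3 + (1 + (8 * (s * 2) + 2))) ≡ 14 * (s * 2) + 6
  eq₂-₁ = solve-∀
  eq₀-₂ : ∀ s → (1 + s * 2) * 3 ≡ (1 + ((3 * s + 1) * 2))
  eq₀-₂ = solve-∀
  eq₁-₂ : ∀ s → 3 * (8 * (1 + s * 2) + 2) + 2 ≡ 8 * (1 + ((1 + s * 2) * 3))
  eq₁-₂ = solve-∀
  eq₃-₂ : ∀ s → 2 + (1 + s * 2) * 3 ≡ (1 + ((3 * s + 2) * 2))
  eq₃-₂ = solve-∀
  eq₄-₂ : ∀ s → (1 + (8 * (1 + s * 2) + 2)) ≡ (1 + ((8 * s + 5) * 2))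
  eq₄-₂ = solve-∀
  eq₂-₂ : ∀ s → (1 + ((1 + s * 2) * 3)) + (3 + (1 + s * 2) * 3 + (2 + (8 * (1 + s * 2) + 2))) ≡ 14 * (1 + s * 2) + 8
  eq₂-₂ = solve-∀
  eq₀-₃ : ∀ s → 1 + s * 2 * 3 ≡ (1 + (3 * s * 2))
  eq₀-₃ = solve-∀
  eq₁-₃ : ∀ s → 3 * (8 * (s * 2) + 5) + 1 ≡ 8 * (1 + (1 + s * 2 * 3))
  eq₁-₃ = solve-∀
  eq₃-₃ : ∀ s → 3 + s * 2 * 3 ≡ (1 + ((3 * s + 1) * 2))
  eq₃-₃ = solve-∀
  eq₂-₃ : ∀ s → 2 + s * 2 * 3 + (4 + s * 2 * 3 + (1 + (8 * (s * 2) + 5))) ≡ 14 * (s * 2) + 12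
  eq₂-₃ = solve-∀
  eq₁-₄ : ∀ s → 3 * (8 * (1 + s * 2) + 5) + 1 ≡ 8 * (1 + (1 + (1 + s * 2) * 3))
  eq₁-₄ = solve-∀
  eq₂-₄ : ∀ s → 2 + (1 + s * 2) * 3 + (3 + (1 + s * 2) * 3 + (1 + (8 * (1 + s * 2) + 5))) ≡ 14 * (1 + s * 2) + 11
  eq₂-₄ = solve-∀
  eq₁-₅ : ∀ s → 3 * (8 * (s * 2) + 7) + 3 ≡ 8 * (1 + (2 + s * 2 * 3))
  eq₁-₅ = solve-∀
  eq₂-₅ : ∀ s → 3 + s * 2 * 3 + (4 + s * 2 * 3 + (1 + (8 * (s * 2) + 7))) ≡ 14 * (s * 2) + 15
  eq₂-₅ = solve-∀
  eq₀-₆ : ∀ s → 2 + (1 + s * 2) * 3 ≡ (1 + ((3 * s + 2) * 2))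
  eq₀-₆ = solve-∀
  eq₁-₆ : ∀ s → 3 * (8 * (1 + s * 2) + 7) + 3 ≡ 8 * (1 + (2 + (1 + s * 2) * 3))
  eq₁-₆ = solve-∀
  eq₃-₆ : ∀ s → 4 + (1 + s * 2) * 3 ≡ (1 + ((3 * s + 3) * 2))
  eq₃-₆ = solve-∀
  eq₂-₆ : ∀ s → 3 + (1 + s * 2) * 3 + (5 + (1 + s * 2) * 3 + (1 + (8 * (1 + s * 2) + 7))) ≡ 14 * (1 + s * 2) + 16
  eq₂-₆ = solve-∀

module Orders {n k c a p : ℕ} (order : c + (a + p) ≡ n) (c-bound : suc k ≤ c) (a-bound : suc (suc k) ≤ a)
  (p-bound : 8 * suc k ≤ 3 * p) (even : ¬ 2 ∣ k → 2 ∣ c × 2 ∣ a × 2 ∣ p) where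

  total : ∀ {x y z m} → x ≤ c → y ≤ a → z ≤ p → x + (y + z) ≡ m → m ≤ n
  total x≤c y≤a z≤p refl = subst (_ ≤_) order (+-mono-≤ x≤c (+-mono-≤ y≤a z≤p))

  n-even : ¬ 2 ∣ k → n % 2 ≡ 0
  n-even k-odd = let c-even , a-even , p-even = even k-odd in
    n∣m⇒m%n≡0 n 2 (subst (2 ∣_) order (∣m∣n⇒∣m+n c-even (∣m∣n⇒∣m+n a-even p-even)))

  -- Rounding up: with remainders `suc y` from 1 to 3 instead of 0 to 2, `suc x` is the ceiling of
  -- `8(k + 1) / 3`.
  p-above : ∀ {x y} → 3 * x + suc y ≡ 8 * suc k → suc x ≤ p
  p-above {x} {y} eq = *-cancelˡ-< 3 x p (≤-trans (m<m+n (3 * x) (s≤s z≤n)) (≤-trans (≤-reflexive eq) p-bound))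

  module _ (q s : ℕ) where

    order₁ : k ≡ q * 3 → q ≡ s * 2 → 14 * q + 6 ≤ n
    order₁ refl refl = total c-bound a-bound (p-above {8 * q + 2} {1} (eq₁-₁ s)) (eq₂-₁ s)

    order₂ : k ≡ q * 3 → q ≡ 1 + s * 2 → n % 2 ≡ 0 × 14 * q + 8 ≤ n
    order₂ refl refl = n-even k-odd ,
      total c-bound (even-up (3 * s + 2) (eq₃-₂ s) a-even a-bound)
        (even-up (8 * s + 5) (eq₄-₂ s) p-even (p-above {8 * q + 2} {1} (eq₁-₂ s))) (eq₂-₂ s)
      where
      k-odd = odd (3 * s + 1) (eq₀-₂ s)
      a-even = proj₁ (proj₂ (even k-odd))
      p-even = proj₂ (proj₂ (even k-odd))

    order₃ : k ≡ 1 + q * 3 → q ≡ s * 2 → n % 2 ≡ 0 × 14 * q + 12 ≤ n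
    order₃ refl refl = n-even k-odd ,
      total c-bound (even-up (3 * s + 1) (eq₃-₃ s) a-even a-bound) (p-above {8 * q + 5} {0} (eq₁-₃ s)) (eq₂-₃ s)
      where
      k-odd = odd (3 * s) (eq₀-₃ s)
      a-even = proj₁ (proj₂ (even k-odd))

    order₄ : k ≡ 1 + q * 3 → q ≡ 1 + s * 2 → 14 * q + 11 ≤ n
    order₄ refl refl = total c-bound a-bound (p-above {8 * q + 5} {0} (eq₁-₄ s)) (eq₂-₄ s)

    order₅ : k ≡ 2 + q * 3 → q ≡ s * 2 → 14 * q + 15 ≤ n
    order₅ refl refl = total c-bound a-bound (p-above {8 * q + 7} {2} (eq₁-₅ s)) (eq₂-₅ s)

    order₆ : k ≡ 2 + q * 3 → q ≡ 1 + s * 2 → n % 2 ≡ 0 × 14 * q + 16 ≤ n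
    order₆ refl refl = n-even k-odd ,
      total c-bound (even-up (3 * s + 3) (eq₃-₆ s) a-even a-bound) (p-above {8 * q + 7} {2} (eq₁-₆ s)) (eq₂-₆ s)
      where
      k-odd = odd (3 * s + 2) (eq₀-₆ s)
      a-even = proj₁ (proj₂ (even k-odd))

euclid : ∀ m d .{{_ : NonZero d}} {r} → m % d ≡ r → m ≡ r + m / d * d
euclid m d refl = m≡m%n+[m/n]*n m d

module _ {n k c a p : ℕ} (order : c + (a + p) ≡ n) (c-bound : suc k ≤ c) (a-bound : suc (suc k) ≤ a)
  (p-bound : 8 * suc k ≤ 3 * p) (even : ¬ 2 ∣ k → 2 ∣ c × 2 ∣ a × 2 ∣ p) where

  private
    q = k / 3
    s = q / 2
    module O = Orders order c-bound a-bound p-bound even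

  order-condition : OrderCondition k n
  order-condition =
      (λ kr qr → O.order₁ q s (euclid k 3 kr) (euclid q 2 qr))
    , (λ kr qr → O.order₂ q s (euclid k 3 kr) (euclid q 2 qr))
    , (λ kr qr → O.order₃ q s (euclid k 3 kr) (euclid q 2 qr))
    , (λ kr qr → O.order₄ q s (euclid k 3 kr) (euclid q 2 qr))
    , (λ kr qr → O.order₅ q s (euclid k 3 kr) (euclid q 2 qr))
    , (λ kr qr → O.order₆ q s (euclid k 3 kr) (euclid q 2 qr))

necessary : ∀ k n → Σ (Graph n) (λ G → Connected G × MetricConnectedRegular G k) → OrderCondition k n
necessary k n (G , connected , regular) =
  let c , a , p , order , c-bound , a-bound , p-bound , even = Necessity.bounds {k = k} G connected regular
  in order-condition order c-bound a-bound p-bound even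

-- Gluing central, annular and peripheral graphs

-- Paths to a common `root` suffice for connectedness, since one of two such paths can be reversed.
-- The vertex type is left free so that sums and products can serve as vertex sets.
record RegularGraph (V : Set) (k : ℕ) : Set where
  field
    edge        : V → V → Bool
    edge-sym    : ∀ x y → edge x y ≡ edge y x
    edge-irrefl : ∀ x → edge x x ≡ false
    degree      : ∀ x → HasCount (λ y → edge x y ≡ true) k
    root        : V
    connect     : ∀ x → Star (λ x y → edge x y ≡ true) x root

module _ {W : Set} {k n : ℕ} (H : RegularGraph W k) (G : Graph n) {S : Fin n → Set} (ι : W → Fin n)
  (ι-injective : ∀ {x y} → ι x ≡ ι y → x ≡ y) (S⇔ι : ∀ v → S v ⇔ (∃[ x ] v ≡ ι x))
  (adj-ι : ∀ x y → adj G (ι x) (ι y) ≡ RegularGraph.edge H x y) where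

  open RegularGraph H

  S-ι : ∀ x → S (ι x)
  S-ι x = from (S⇔ι (ι x)) (x , refl)

  induced-connected : ConnectedOn G S
  induced-connected = (ι root , S-ι root) , λ u v Su Sv →
    let x , u≡ιx = to (S⇔ι u) Su
        y , v≡ιy = to (S⇔ι v) Sv
        l , p = walk (connect x)
        m , q = walk (connect y)
    in l + m , subst₂ (λ u v → WalkIn G S u v (l + m)) (≡sym u≡ιx) (≡sym v≡ιy) (walk-trans G p (walk-sym G q))
    where
    walk : ∀ {x y} → Star (λ x y → edge x y ≡ true) x y → ∃[ m ] WalkIn G S (ι x) (ι y) m
    walk {x} ε = 0 , here (S-ι x)
    walk {x} (_◅_ {j = y} xy yz) = _ , step (S-ι x) (trans (adj-ι x y) xy) (proj₂ (walk yz))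

  induced-regular : RegularOn G k S
  induced-regular v Sv with to (S⇔ι v) Sv
  ... | x , refl = count-image ι ι-injective (λ w (Sw , _) → to (S⇔ι w) Sw)
    (count-cong (λ y → mk⇔ (λ xy → S-ι y , trans (adj-ι x y) xy) (λ (_ , xy) → trans (≡sym (adj-ι x y)) xy)) (degree x))

-- Level distances to a fixed peripheral vertex, truncated to the values compatible with the height of
-- an adjacent annular vertex.
clip : Fin 3 → ℕ → ℕ
clip h d = (d ⊓ (2 + toℕ h)) ⊔ toℕ h

-- In range, `clip` leaves level distances unchanged at heights 0 and 2 and truncates them to the
-- interval from 1 to 3 at height 1. Out of range, neighbouring levels with heights 0 and 2 could
-- get values two apart.
InRange : Fin 3 → ℕ → Set
InRange h d = (h ≡ 0F → d ≤ 2) × (h ≡ 2F → 2 ≤ d)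

clip-lipschitz : ∀ h h' i j t → InRange h (levelDist i t) → InRange h' (levelDist j t) → levelDist i j ≤ 1 →
                 clip h (levelDist i t) ≤ suc (clip h' (levelDist j t))
clip-lipschitz = from-yes (all? λ h → all? λ h' → all? λ i → all? λ j → all? λ t →
  inRange? h (levelDist i t) →-dec (inRange? h' (levelDist j t) →-dec ((levelDist i j ≤? 1) →-dec
    (clip h (levelDist i t) ≤? suc (clip h' (levelDist j t))))))
  where
  inRange? : ∀ h d → Dec (InRange h d)
  inRange? h d = ((h ≟ 0F) →-dec (d ≤? 2)) ×-dec ((h ≟ 2F) →-dec (2 ≤? d))

clip≤ : ∀ h d → clip h d ≤ 2 + toℕ h
clip≤ h d = ⊔-lub (m⊓n≤n d (2 + toℕ h)) (m≤n+m (toℕ h) 2)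

levelDist-self : ∀ t → levelDist t t ≡ 0
levelDist-self t rewrite ∣n-n∣≡0 (toℕ t) = refl

-- `same-foot` and `opposite-foot` are the range conditions that keep clipped level distances
-- 1-Lipschitz. `antipode` supplies peripheral vertices at distance 4; `f-surjective` supplies for
-- each annular `a` a peripheral vertex with foot `α a`, hence at distance 3 from `a`.
module Assembly {VC VA VP : Set} {k n : ℕ}
  (HC : RegularGraph VC k) (HA : RegularGraph VA k) (HP : RegularGraph VP k)
  (_≟A_ : (a b : VA) → Dec (a ≡ b)) (level : VP → Fin 8) (f : VP → VA) (α : VA → VA)
  (α-involutive : ∀ a → α (α a) ≡ a) (α-free : ∀ a → α a ≢ a)
  (α-nonadjacent : ∀ a b → RegularGraph.edge HA a b ≡ true → b ≢ α a)
  (level-step : ∀ x y → RegularGraph.edge HP x y ≡ true → levelDist (level x) (level y) ≤ 1)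
  (same-foot : ∀ x t → f x ≡ f t → levelDist (level x) (level t) ≤ 2)
  (opposite-foot : ∀ x t → f x ≡ α (f t) → 2 ≤ levelDist (level x) (level t))
  (antipode : ∀ t → ∃[ x ] (f t ≡ α (f x) × levelDist (level t) (level x) ≡ 4))
  (f-surjective : ∀ a → ∃[ t ] f t ≡ a)
  (iso : (VC ⊎ (VA ⊎ VP)) ↔ Fin n) where

  open RegularGraph

  V = VC ⊎ (VA ⊎ VP)

  pattern C c = inj₁ c
  pattern A a = inj₂ (inj₁ a)
  pattern P x = inj₂ (inj₂ x)

  adjV : V → V → Bool
  adjV (C c) (C d) = edge HC c d
  adjV (C _) (A _) = true
  adjV (C _) (P _) = false
  adjV (A _) (C _) = true
  adjV (A a) (A b) = edge HA a b
  adjV (A a) (P x) = does (f x ≟A a)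
  adjV (P _) (C _) = false
  adjV (P x) (A a) = does (f x ≟A a)
  adjV (P x) (P y) = edge HP x y

  adjV-sym : ∀ u v → adjV u v ≡ adjV v u
  adjV-sym (C c) (C d) = edge-sym HC c d
  adjV-sym (C _) (A _) = refl
  adjV-sym (C _) (P _) = refl
  adjV-sym (A _) (C _) = refl
  adjV-sym (A a) (A b) = edge-sym HA a b
  adjV-sym (A _) (P _) = refl
  adjV-sym (P _) (C _) = refl
  adjV-sym (P _) (A _) = refl
  adjV-sym (P x) (P y) = edge-sym HP x y

  adjV-irrefl : ∀ v → adjV v v ≡ false
  adjV-irrefl (C c) = edge-irrefl HC c
  adjV-irrefl (A a) = edge-irrefl HA a
  adjV-irrefl (P x) = edge-irrefl HP x

  ι : V → Fin n
  ι = Inverse.to iso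

  κ : Fin n → V
  κ = Inverse.from iso

  ικ : ∀ v → ι (κ v) ≡ v
  ικ = Inverse.strictlyInverseˡ iso

  κι : ∀ x → κ (ι x) ≡ x
  κι = Inverse.strictlyInverseʳ iso

  ι-injective : ∀ {x y} → ι x ≡ ι y → x ≡ y
  ι-injective {x} {y} eq = trans (≡sym (κι x)) (trans (cong κ eq) (κι y))

  G : Graph n
  G = record
    { adj = λ u v → adjV (κ u) (κ v)
    ; sym = λ u v → adjV-sym (κ u) (κ v)
    ; irrefl = λ v → adjV-irrefl (κ v) }

  adj-ι : ∀ x y → adj G (ι x) (ι y) ≡ adjV x y
  adj-ι x y = cong₂ adjV (κι x) (κι y)

  -- The distance from `a` to the foot of `t`, except that vertices at distance 2 other than the
  -- opposite one get 1: only the opposite vertex has to be certified as far.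
  height : VP → VA → Fin 3
  height t a = if does (a ≟A f t) then 0F else if does (a ≟A α (f t)) then 2F else 1F

  height-0 : ∀ t a → height t a ≡ 0F → a ≡ f t
  height-0 t a eq with a ≟A f t | a ≟A α (f t)
  height-0 t a eq | yes p | _     = p
  height-0 t a () | no _  | yes _
  height-0 t a () | no _  | no _

  height-2 : ∀ t a → height t a ≡ 2F → a ≡ α (f t)
  height-2 t a eq with a ≟A f t | a ≟A α (f t)
  height-2 t a () | yes _ | _
  height-2 t a eq | no _  | yes p = p
  height-2 t a () | no _  | no _

  height-foot : ∀ t → height t (f t) ≡ 0F
  height-foot t rewrite dec-true (f t ≟A f t) refl = refl

  height-opposite : ∀ t → height t (α (f t)) ≡ 2F
  height-opposite t rewrite dec-false (α (f t) ≟A f t) (α-free (f t)) | dec-true (α (f t) ≟A α (f t)) refl = refl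

  inRange : ∀ t x → InRange (height t (f x)) (levelDist (level x) (level t))
  inRange t x = same-foot x t ∘ height-0 t (f x) , opposite-foot x t ∘ height-2 t (f x)

  -- A 1-Lipschitz function vanishing at t, hence a lower bound for the distance to t.
  potential : VP → V → ℕ
  potential t (C _) = 2
  potential t (A a) = suc (toℕ (height t a))
  potential t (P x) = clip (height t (f x)) (levelDist (level x) (level t))

  heights-close : ∀ (h h' : Fin 3) → (h ≡ 2F → h' ≢ 0F) → toℕ h ≤ suc (toℕ h')
  heights-close zero _ _ = z≤n
  heights-close (suc zero) _ _ = s≤s z≤n
  heights-close (suc (suc zero)) zero ne = ⊥-elim (ne refl refl)
  heights-close (suc (suc zero)) (suc _) _ = s≤s (s≤s z≤n)

  lipschitz : ∀ t u v → adjV u v ≡ true → potential t u ≤ suc (potential t v)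
  lipschitz t (C _) (C _) _ = n≤1+n 2
  lipschitz t (C _) (A a) _ = s≤s (s≤s z≤n)
  lipschitz t (A a) (C _) _ = s≤s (toℕ≤pred[n] (height t a))
  lipschitz t (A a) (A b) ab = s≤s (heights-close (height t a) (height t b) λ top bottom →
    α-nonadjacent a b ab (trans (height-0 t b bottom)
      (trans (≡sym (α-involutive (f t))) (cong α (≡sym (height-2 t a top))))))
  -- The maximum in `clip` keeps a peripheral vertex at most one below its foot; the minimum, used
  -- in the next case, keeps it at most one above.
  lipschitz t (A a) (P x) ax with does-sound (f x ≟A a) ax
  ... | refl = s≤s (m≤n⊔m _ (toℕ (height t a)))
  lipschitz t (P x) (A a) xa with does-sound (f x ≟A a) xa
  ... | refl = clip≤ (height t a) _
  lipschitz t (P x) (P y) xy = clip-lipschitz (height t (f x)) (height t (f y)) (level x) (level y) (level t)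
    (inRange t x) (inRange t y) (level-step x y xy)

  potential-self : ∀ t → potential t (P t) ≡ 0
  potential-self t rewrite height-foot t | levelDist-self (level t) = refl

  walk-bound : ∀ t {u v m} → Walk G u v m → potential t (κ u) ≤ m + potential t (κ v)
  walk-bound t (here _) = ≤-refl
  walk-bound t {u} (step {w = w} _ uw p) = ≤-trans (lipschitz t (κ u) (κ w) uw) (s≤s (walk-bound t p))

  distance-bound : ∀ t {x m} → Walk G (ι x) (ι (P t)) m → potential t x ≤ m
  distance-bound t {x} {m} p = begin
    potential t x                       ≡⟨ cong (potential t) (κι x) ⟨
    potential t (κ (ι x))               ≤⟨ walk-bound t p ⟩
    m + potential t (κ (ι (P t)))       ≡⟨ cong (λ v → m + potential t v) (κι (P t)) ⟩
    m + potential t (P t)               ≡⟨ cong (m +_) (potential-self t) ⟩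
    m + 0                               ≡⟨ +-identityʳ m ⟩
    m                                   ∎
    where open ≤-Reasoning

  go : ∀ x y {v m} → adjV x y ≡ true → Walk G (ι y) v m → Walk G (ι x) v (suc m)
  go x y xy p = step tt (trans (adj-ι x y) xy) p

  stop : ∀ x → Walk G (ι x) (ι x) 0
  stop x = here tt

  foot-edge : ∀ x → adjV (P x) (A (f x)) ≡ true
  foot-edge x = dec-true (f x ≟A f x) refl

  c₀ = root HC
  a₀ = root HA

  eccentricity : V → ℕ
  eccentricity (C _) = 2
  eccentricity (A _) = 3
  eccentricity (P _) = 4

  reach : ∀ x y → ∃[ m ] (Walk G (ι x) (ι y) m × m ≤ eccentricity x)
  reach (C c) y@(C d) = _ , go (C c) (A a₀) refl (go (A a₀) y refl (stop y)) , ≤-refl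
  reach (C c) y@(A a) = _ , go (C c) y refl (stop y) , s≤s z≤n
  reach (C c) y@(P x) = _ , go (C c) (A (f x)) refl (go (A (f x)) y (foot-edge x) (stop y)) , ≤-refl
  reach (A a) y@(C d) = _ , go (A a) y refl (stop y) , s≤s z≤n
  reach (A a) y@(A b) = _ , go (A a) (C c₀) refl (go (C c₀) y refl (stop y)) , s≤s (s≤s z≤n)
  reach (A a) (P x)   = let _ , p , m≤2 = reach (C c₀) (P x) in _ , go (A a) (C c₀) refl p , s≤s m≤2
  reach (P x) y@(C d) = _ , go (P x) (A (f x)) (foot-edge x) (go (A (f x)) y refl (stop y)) , s≤s (s≤s z≤n)
  reach (P x) y@(A b) =
    _ , go (P x) (A (f x)) (foot-edge x) (go (A (f x)) (C c₀) refl (go (C c₀) y refl (stop y))) , s≤s (s≤s (s≤s z≤n))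
  reach (P x) (P y)   =
    let _ , p , m≤2 = reach (C c₀) (P y)
    in _ , go (P x) (A (f x)) (foot-edge x) (go (A (f x)) (C c₀) refl p) , s≤s (s≤s m≤2)

  -- For an annular vertex the target has the opposite foot. For a peripheral vertex the two feet
  -- are opposite, so the height is 2 and the level distance 4 passes unclipped.
  farthest : ∀ x → ∃[ t ] eccentricity x ≡ potential t x
  farthest (C _) = proj₁ (f-surjective a₀) , refl
  farthest (A a) with f-surjective (α a)
  ... | t , ft≡αa = t , ≡sym (cong (suc ∘ toℕ) (trans (cong (height t) a≡αft) (height-opposite t)))
    where a≡αft = trans (≡sym (α-involutive a)) (cong α (≡sym ft≡αa))
  farthest (P x) with antipode x
  ... | t , fx≡αft , dist4 = t , ≡sym (cong₂ clip (trans (cong (height t) fx≡αft) (height-opposite t)) dist4)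

  ecc-ι : ∀ x → Ecc G (ι x) (eccentricity x)
  ecc-ι x = ecc-intro G
    (λ u → subst (λ u → ∃[ m ] (Walk G (ι x) u m × m ≤ eccentricity x)) (ικ u) (reach x (κ u)))
    (let t , ecc≡ = farthest x in ι (P t) , λ m p → subst (_≤ m) (≡sym ecc≡) (distance-bound t p))

  ecc : ∀ v → Ecc G v (eccentricity (κ v))
  ecc v = subst (λ u → Ecc G u (eccentricity (κ v))) (ικ v) (ecc-ι (κ v))

  bounded : ∀ x → 2 ≤ eccentricity x × eccentricity x ≤ 4
  bounded (C _) = ≤-refl , s≤s (s≤s z≤n)
  bounded (A _) = s≤s (s≤s z≤n) , s≤s (s≤s (s≤s z≤n))
  bounded (P _) = s≤s (s≤s z≤n) , ≤-refl

  rad : Rad G 2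
  rad = (ι (C c₀) , ecc-ι (C c₀)) , λ v e E → subst (2 ≤_) (ecc-unique G (ecc v) E) (proj₁ (bounded (κ v)))

  diam : Diam G 4
  diam = (ι (P (root HP)) , ecc-ι (P (root HP))) ,
         λ v e E → subst (_≤ 4) (ecc-unique G (ecc v) E) (proj₂ (bounded (κ v)))

  center⇔ : ∀ v → Center G v ⇔ (∃[ c ] v ≡ ι (C c))
  center⇔ v = mk⇔
    (λ (_ , rad' , E) → forth (κ v) (ικ v) (trans (ecc-unique G (ecc v) E) (rad-unique G rad' rad)))
    (λ { (c , refl) → 2 , rad , ecc-ι (C c) })
    where
    forth : ∀ x → ι x ≡ v → eccentricity x ≡ 2 → ∃[ c ] v ≡ ι (C c)
    forth (C c) eq _ = c , ≡sym eq
    forth (A _) _ ()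
    forth (P _) _ ()

  annulus⇔ : ∀ v → Annulus G v ⇔ (∃[ a ] v ≡ ι (A a))
  annulus⇔ v = mk⇔
    (λ (_ , _ , _ , rad' , diam' , E , r<e , e<D) → forth (κ v) (ικ v)
      (subst₂ _<_ (rad-unique G rad' rad) (ecc-unique G E (ecc v)) r<e)
      (subst₂ _<_ (ecc-unique G E (ecc v)) (diam-unique G diam' diam) e<D))
    (λ { (a , refl) → 2 , 4 , 3 , rad , diam , ecc-ι (A a) , ≤-refl , ≤-refl })
    where
    forth : ∀ x → ι x ≡ v → 2 < eccentricity x → eccentricity x < 4 → ∃[ a ] v ≡ ι (A a)
    forth (C _) _ (s≤s (s≤s ())) _
    forth (A a) eq _ _ = a , ≡sym eq
    forth (P _) _ _ (s≤s (s≤s (s≤s (s≤s ()))))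

  periphery⇔ : ∀ v → Periphery G v ⇔ (∃[ x ] v ≡ ι (P x))
  periphery⇔ v = mk⇔
    (λ (_ , diam' , E) → forth (κ v) (ικ v) (trans (ecc-unique G (ecc v) E) (diam-unique G diam' diam)))
    (λ { (x , refl) → 4 , diam , ecc-ι (P x) })
    where
    forth : ∀ x → ι x ≡ v → eccentricity x ≡ 4 → ∃[ x ] v ≡ ι (P x)
    forth (C _) _ ()
    forth (A _) _ ()
    forth (P x) eq _ = x , ≡sym eq

  connected : Connected G
  connected = (ι (C c₀) , tt) , λ u v _ _ →
    let m , p , _ = reach (κ u) (κ v) in m , subst₂ (λ u v → Walk G u v m) (ικ u) (ικ v) p

  assembled : Σ (Graph n) (λ G → Connected G × MetricConnectedRegular G k)
  assembled = G , connected ,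
    (induced-connected HC G (ι ∘ inj₁) injC center⇔ (λ c d → adj-ι (C c) (C d)) ,
     induced-regular HC G (ι ∘ inj₁) injC center⇔ (λ c d → adj-ι (C c) (C d))) ,
    (induced-connected HA G (ι ∘ inj₂ ∘ inj₁) injA annulus⇔ (λ a b → adj-ι (A a) (A b)) ,
     induced-regular HA G (ι ∘ inj₂ ∘ inj₁) injA annulus⇔ (λ a b → adj-ι (A a) (A b))) ,
    (induced-connected HP G (ι ∘ inj₂ ∘ inj₂) injP periphery⇔ (λ x y → adj-ι (P x) (P y)) ,
     induced-regular HP G (ι ∘ inj₂ ∘ inj₂) injP periphery⇔ (λ x y → adj-ι (P x) (P y)))
    where
    injC : ∀ {c d} → ι (C c) ≡ ι (C d) → c ≡ d
    injC = inj₁-injective ∘ ι-injective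
    injA : ∀ {a b} → ι (A a) ≡ ι (A b) → a ≡ b
    injA = inj₁-injective ∘ inj₂-injective ∘ ι-injective
    injP : ∀ {x y} → ι (P x) ≡ ι (P y) → x ≡ y
    injP = inj₂-injective ∘ inj₂-injective ∘ ι-injective

-- Central graphs: circulants

sumTo : (ℕ → ℕ) → ℕ → ℕ
sumTo f m = ∑[ i < m ] f (toℕ i)

sumTo-suc : ∀ f m → sumTo f (suc m) ≡ sumTo f m + f m
sumTo-suc f zero    = +-identityʳ (f 0)
sumTo-suc f (suc m) = trans (cong (f 0 +_) (sumTo-suc (f ∘ suc) m)) (≡sym (+-assoc (f 0) _ _))

sumTo-+ : ∀ f a b → sumTo f (a + b) ≡ sumTo f a + sumTo (λ i → f (a + i)) b
sumTo-+ f zero    b = refl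
sumTo-+ f (suc a) b = trans (cong (f 0 +_) (sumTo-+ (f ∘ suc) a b)) (≡sym (+-assoc (f 0) _ _))

sumTo-const : ∀ {f} a c → (∀ i → i < a → f i ≡ c) → sumTo f a ≡ a * c
sumTo-const a c eq = trans (sum-cong-≗ {a} (λ i → eq (toℕ i) (toℕ<n i))) (sum-const a c)

-- Differences are taken in ℕ rather than modulo `m`; `D-sym` identifies `d` with `m - d`, which
-- makes adjacency invariant under rotation.
module Circulant {m' : ℕ} (D : ℕ → Bool) (D-0 : D 0 ≡ false) (D-1 : D 1 ≡ true)
  (D-sym : ∀ d d' → suc d + suc d' ≡ suc m' → D (suc d) ≡ D (suc d')) where

  m : ℕ
  m = suc m'

  row : ℕ → ℕ → ℕ
  row v w = ind (D ∣ v - w ∣)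

  -- Row `v + 1` is row `v` moved by one place: `D (v + 1)` enters in front, `D (m' - v)` drops out
  -- at the end, and `D-sym` makes the two equal.
  row-sum : ∀ v → v < m → sumTo (row v) m ≡ sumTo (ind ∘ D) m
  row-sum zero    _            = refl
  row-sum (suc v) (s≤s v<m') = begin
    ind (D (suc v)) + sumTo (row v) m'    ≡⟨ +-comm _ (sumTo (row v) m') ⟩
    sumTo (row v) m' + ind (D (suc v))    ≡⟨ cong (λ b → sumTo (row v) m' + ind b) reflect ⟩
    sumTo (row v) m' + row v m'           ≡⟨ sumTo-suc (row v) m' ⟨
    sumTo (row v) m                       ≡⟨ row-sum v (m<n⇒m<1+n v<m') ⟩
    sumTo (ind ∘ D) m                     ∎
    where
    open ≡-Reasoning
    reflect : D (suc v) ≡ D ∣ v - m' ∣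
    reflect = let d , eq = m≤n⇒∃[o]m+o≡n v<m'
                  eq' = trans (+-suc v d) eq
      in trans (D-sym v d (cong suc eq')) (cong D (≡sym (trans (m≤n⇒∣m-n∣≡n∸m (<⇒≤ v<m'))
           (trans (cong (_∸ v) (≡sym eq')) (m+n∸m≡n v (suc d))))))

  edge : Fin m → Fin m → Bool
  edge u v = D ∣ toℕ u - toℕ v ∣

  circulant : ∀ {k} → sumTo (ind ∘ D) m ≡ k → RegularGraph (Fin m) k
  circulant {k} total = record
    { edge = edge
    ; edge-sym = λ u v → cong D (∣-∣-comm (toℕ u) (toℕ v))
    ; edge-irrefl = λ v → trans (cong D (∣n-n∣≡0 (toℕ v))) D-0
    ; degree = degree
    ; root = zero
    ; connect = <-weakInduction (λ x → Star (λ x y → edge x y ≡ true) x zero) ε (λ i p → down i ◅ p)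
    }
    where
    down : ∀ i → edge (suc i) (inject₁ i) ≡ true
    down i = trans (cong D (trans (cong (λ j → ∣ suc (toℕ i) - j ∣) (toℕ-inject₁ i))
      (trans (m≤n⇒∣n-m∣≡n∸m (n≤1+n (toℕ i))) (m+n∸n≡m 1 (toℕ i))))) D-1
    degree : ∀ x → HasCount (λ y → edge x y ≡ true) k
    degree x = subst (HasCount _) (trans (length-filter-tabulate E? id)
      (trans (sum-cong-≗ (λ y → cong ind (does-≟true (edge x y)))) (trans (row-sum (toℕ x) (toℕ<n x)) total)))
      (count-filter E?)
      where
      E? : ∀ y → Dec (edge x y ≡ true)
      E? y = edge x y Boolₚ.≟ true
      does-≟true : ∀ b → does (b Boolₚ.≟ true) ≡ b
      does-≟true true  = refl
      does-≟true false = refl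

module Jumps (h m : ℕ) (b : Bool) where

  -- Cyclic distance at most `h`, with `m - d ≤ h` rewritten to avoid truncated subtraction. For
  -- `b = true` the half-turn is added, to obtain odd degrees.
  Jump : ℕ → Set
  Jump d = 1 ≤ d × (d ≤ h ⊎ m ≤ h + d ⊎ (b ≡ true × d + d ≡ m))

  jump? : ∀ d → Dec (Jump d)
  jump? d = 1 ≤? d ×-dec (d ≤? h ⊎-dec m ≤? h + d ⊎-dec ((b Boolₚ.≟ true) ×-dec (d + d ℕₚ.≟ m)))

  jump : ℕ → Bool
  jump d = does (jump? d)

  jump-reflect : ∀ d d' → suc d + suc d' ≡ m → Jump (suc d) → Jump (suc d')
  jump-reflect d d' eq (_ , inj₁ d≤h) =
    s≤s z≤n , inj₂ (inj₁ (≤-trans (≤-reflexive (≡sym eq)) (+-monoˡ-≤ (suc d') d≤h)))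
  jump-reflect d d' eq (_ , inj₂ (inj₁ m≤h+d)) =
    s≤s z≤n , inj₁ (+-cancelʳ-≤ (suc d) (suc d') h (≤-trans (≤-reflexive (trans (+-comm (suc d') (suc d)) eq)) m≤h+d))
  jump-reflect d d' eq (_ , inj₂ (inj₂ (b≡ , 2d≡m))) =
    s≤s z≤n , inj₂ (inj₂ (b≡ , subst (λ x → x + x ≡ m) (+-cancelˡ-≡ (suc d) _ _ (trans 2d≡m (≡sym eq))) 2d≡m))

  jump-sym : ∀ d d' → suc d + suc d' ≡ m → jump (suc d) ≡ jump (suc d')
  jump-sym d d' eq = ≡-from-⇔
    (dec-true (jump? (suc d')) ∘ jump-reflect d d' eq ∘ does-sound (jump? (suc d)))
    (dec-true (jump? (suc d)) ∘ jump-reflect d' d (trans (+-comm (suc d') (suc d)) eq) ∘ does-sound (jump? (suc d')))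

  jumps : ∀ {f : ℕ → ℕ} a → (∀ i → i < a → Jump (f i)) → sumTo (ind ∘ jump ∘ f) a ≡ a
  jumps {f} a all = trans (sumTo-const a 1 (λ i i<a → cong ind (dec-true (jump? (f i)) (all i i<a)))) (*-identityʳ a)

  no-jumps : ∀ {f : ℕ → ℕ} a → (∀ i → i < a → ¬ Jump (f i)) → sumTo (ind ∘ jump ∘ f) a ≡ 0
  no-jumps {f} a none = trans (sumTo-const a 0 (λ i i<a → cong ind (dec-false (jump? (f i)) (none i i<a)))) (*-zeroʳ a)

-- The nonzero differences are `h` jumps, `g` non-jumps and `h` jumps. As `g` is arbitrary, every
-- order from `2h + 1` on occurs.
circulant-even : ∀ h' g → let h = suc h' in RegularGraph (Fin (suc (h + (g + h)))) (h + h)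
circulant-even h' g = Circulant.circulant jump refl (dec-true (jump? 1) (s≤s z≤n , inj₁ (s≤s z≤n))) jump-sym total
  where
  h = suc h'
  m = suc (h + (g + h))
  open Jumps h m false
  low : ∀ i → i < h → Jump (suc i)
  low i i<h = s≤s z≤n , inj₁ i<h
  middle : ∀ i → i < g → ¬ Jump (suc (h + i))
  middle i i<g (_ , inj₁ le) = <⇒≱ (s≤s (m≤m+n h i)) le
  middle i i<g (_ , inj₂ (inj₁ le)) = <⇒≱ i<g (+-cancelʳ-≤ h g i (+-cancelˡ-≤ (suc h) _ _ (≤-trans le (≤-reflexive (eq h i)))))
    where
    eq : ∀ h i → h + (1 + (h + i)) ≡ 1 + h + (i + h)
    eq = solve-∀
  high : ∀ i → i < h → Jump (suc (h + (g + i)))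
  high i _ = s≤s z≤n , inj₂ (inj₁ (≤-trans (m≤m+n m i) (≤-reflexive (eq h g i))))
    where
    eq : ∀ h g i → 1 + (h + (g + h)) + i ≡ h + (1 + (h + (g + i)))
    eq = solve-∀
  total : sumTo (ind ∘ jump) m ≡ h + h
  total = begin
    sumTo (ind ∘ jump ∘ suc) (h + (g + h))
      ≡⟨ sumTo-+ (ind ∘ jump ∘ suc) h (g + h) ⟩
    sumTo (ind ∘ jump ∘ suc) h + sumTo (λ i → ind (jump (suc (h + i)))) (g + h)
      ≡⟨ cong₂ _+_ (jumps h low) (sumTo-+ (λ i → ind (jump (suc (h + i)))) g h) ⟩
    h + (sumTo (λ i → ind (jump (suc (h + i)))) g + sumTo (λ i → ind (jump (suc (h + (g + i))))) h)
      ≡⟨ cong (h +_) (cong₂ _+_ (no-jumps g middle) (jumps h high)) ⟩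
    h + h ∎
    where open ≡-Reasoning

-- The half-turn sits between two blocks of `t` non-jumps, which makes the order even, as odd degree
-- requires.
circulant-odd : ∀ h' t → let h = suc h' in RegularGraph (Fin (suc (h + (t + suc (t + h))))) (suc (h + h))
circulant-odd h' t = Circulant.circulant jump refl (dec-true (jump? 1) (s≤s z≤n , inj₁ (s≤s z≤n))) jump-sym total
  where
  h = suc h'
  m = suc (h + (t + suc (t + h)))
  open Jumps h m true
  low : ∀ i → i < h → Jump (suc i)
  low i i<h = s≤s z≤n , inj₁ i<h
  middle : ∀ i → i < t → ¬ Jump (suc (h + i))
  middle i i<t (_ , inj₁ le) = <⇒≱ (s≤s (m≤m+n h i)) le
  middle i i<t (_ , inj₂ (inj₁ le)) =
    <⇒≱ (≤-trans i<t (m≤m+n t _)) (+-cancelʳ-≤ h _ i (+-cancelˡ-≤ (suc h) _ _ (≤-trans (≤-reflexive (eq₁ h t)) (≤-trans le (≤-reflexive (eq₂ h i))))))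
    where
    eq₁ : ∀ h t → 1 + h + (t + (1 + t) + h) ≡ 1 + (h + (t + (1 + (t + h))))
    eq₁ = solve-∀
    eq₂ : ∀ h i → h + (1 + (h + i)) ≡ 1 + h + (i + h)
    eq₂ = solve-∀
  middle i i<t (_ , inj₂ (inj₂ (_ , 2d≡m))) = <⇒≢ (≤-trans (+-mono-< lt lt) (≤-reflexive (eq h t))) 2d≡m
    where
    lt : suc (h + i) < suc (h + t)
    lt = s≤s (+-monoʳ-< h i<t)
    eq : ∀ h t → 1 + (h + t) + (1 + (h + t)) ≡ 1 + (h + (t + (1 + (t + h))))
    eq = solve-∀
  centre : Jump (suc (h + (t + 0)))
  centre = s≤s z≤n , inj₂ (inj₂ (refl , eq h t))
    where
    eq : ∀ h t → 1 + (h + (t + 0)) + (1 + (h + (t + 0))) ≡ 1 + (h + (t + (1 + (t + h))))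
    eq = solve-∀
  middle' : ∀ i → i < t → ¬ Jump (suc (h + (t + suc i)))
  middle' i i<t (_ , inj₁ le) = <⇒≱ (s≤s (m≤m+n h _)) le
  middle' i i<t (_ , inj₂ (inj₁ le)) =
    <⇒≱ i<t (+-cancelˡ-≤ (h + h + t + 2) t i (≤-trans (≤-reflexive (eq₁ h t)) (≤-trans le (≤-reflexive (eq₂ h t i)))))
    where
    eq₁ : ∀ h t → h + h + t + 2 + t ≡ 1 + (h + (t + (1 + (t + h))))
    eq₁ = solve-∀
    eq₂ : ∀ h t i → h + (1 + (h + (t + (1 + i)))) ≡ h + h + t + 2 + i
    eq₂ = solve-∀
  middle' i i<t (_ , inj₂ (inj₂ (_ , 2d≡m))) = <⇒≢ (≤-trans (≤-reflexive (eq₁ h t)) (≤-trans (m≤m+n _ (suc (i + i))) (≤-reflexive (eq₂ h t i)))) (≡sym 2d≡m)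
    where
    eq₁ : ∀ h t → 1 + (1 + (h + (t + (1 + (t + h))))) ≡ 2 * (h + t) + 3
    eq₁ = solve-∀
    eq₂ : ∀ h t i → 2 * (h + t) + 3 + (1 + (i + i)) ≡ 1 + (h + (t + (1 + i))) + (1 + (h + (t + (1 + i))))
    eq₂ = solve-∀
  high : ∀ i → i < h → Jump (suc (h + (t + suc (t + i))))
  high i _ = s≤s z≤n , inj₂ (inj₁ (≤-trans (m≤m+n m i) (≤-reflexive (eq h t i))))
    where
    eq : ∀ h t i → 1 + (h + (t + (1 + (t + h)))) + i ≡ h + (1 + (h + (t + (1 + (t + i)))))
    eq = solve-∀
  from-low : ℕ → ℕ
  from-low i = ind (jump (suc (h + i)))
  from-centre : ℕ → ℕ
  from-centre i = ind (jump (suc (h + (t + i))))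
  total : sumTo (ind ∘ jump) m ≡ suc (h + h)
  total = begin
    sumTo (ind ∘ jump ∘ suc) (h + (t + suc (t + h)))
      ≡⟨ sumTo-+ (ind ∘ jump ∘ suc) h (t + suc (t + h)) ⟩
    sumTo (ind ∘ jump ∘ suc) h + sumTo from-low (t + suc (t + h))
      ≡⟨ cong₂ _+_ (jumps h low) (sumTo-+ from-low t (suc (t + h))) ⟩
    h + (sumTo from-low t + (from-centre 0 + sumTo (from-centre ∘ suc) (t + h)))
      ≡⟨ cong (h +_) (cong₂ _+_ (no-jumps t middle)
           (cong₂ _+_ (cong ind (dec-true (jump? _) centre)) (sumTo-+ (from-centre ∘ suc) t h))) ⟩
    h + suc (sumTo (from-centre ∘ suc) t + sumTo (λ i → from-centre (suc (t + i))) h)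
      ≡⟨ cong (λ x → h + suc x) (cong₂ _+_ (no-jumps t middle') (jumps h high)) ⟩
    h + suc h
      ≡⟨ +-suc h h ⟩
    suc (h + h) ∎
    where open ≡-Reasoning

-- Annular graphs: two cliques

distinct? : ∀ {n} → Fin n → Fin n → Bool
distinct? x y = not (does (x ≟ y))

distinct-sound : ∀ {n} (x y : Fin n) → distinct? x y ≡ true → x ≢ y
distinct-sound x y eq with x ≟ y
distinct-sound x y eq | no x≢y = x≢y

distinct-complete : ∀ {n} {x y : Fin n} → x ≢ y → distinct? x y ≡ true
distinct-complete {x = x} {y} x≢y = cong not (dec-false (x ≟ y) x≢y)

distinct-irrefl : ∀ {n} (x : Fin n) → distinct? x x ≡ false
distinct-irrefl x = cong not (dec-true (x ≟ x) refl)

distinct-sym : ∀ {n} (x y : Fin n) → distinct? x y ≡ distinct? y x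
distinct-sym x y = ≡-from-⇔ (λ eq → distinct-complete (≢-sym (distinct-sound x y eq)))
                            (λ eq → distinct-complete (≢-sym (distinct-sound y x eq)))

count-distinct : ∀ {n} (x : Fin (suc n)) → HasCount (λ y → distinct? x y ≡ true) n
count-distinct {n} x = count-cong
  (λ y → mk⇔ (λ (_ , y≢x) → distinct-complete (≢-sym y≢x)) (λ eq → tt , ≢-sym (distinct-sound x y eq)))
  (count-remove x tt (count-all (suc n)))

count-inhabited : ∀ {V : Set} {T : V → Set} {k} → HasCount T (suc k) → ∃[ x ] T x
count-inhabited (x ∷ L , _ , _ , mem) = x , to (mem x) (Any.here refl)

-- `swap`, exchanging the two copies of a vertex, will be the `α` of `Assembly`; `cross-irrefl`
-- makes such copies non-adjacent. Each vertex has `suc j > 0` cross edges, so the cliques are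
-- joined.
module TwoCliques {m j : ℕ} (cross : Fin (suc m) → Fin (suc m) → Bool)
  (cross-irrefl : ∀ x → cross x x ≡ false)
  (rows : ∀ x → HasCount (λ y → cross x y ≡ true) (suc j))
  (columns : ∀ y → HasCount (λ x → cross x y ≡ true) (suc j)) where

  V = Fin (suc m) ⊎ Fin (suc m)

  edge : V → V → Bool
  edge (inj₁ x) (inj₁ y) = distinct? x y
  edge (inj₁ x) (inj₂ y) = cross x y
  edge (inj₂ y) (inj₁ x) = cross x y
  edge (inj₂ x) (inj₂ y) = distinct? x y

  edge-sym : ∀ u v → edge u v ≡ edge v u
  edge-sym (inj₁ x) (inj₁ y) = distinct-sym x y
  edge-sym (inj₁ x) (inj₂ y) = refl
  edge-sym (inj₂ y) (inj₁ x) = refl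
  edge-sym (inj₂ x) (inj₂ y) = distinct-sym x y

  edge⇒≢swap : ∀ u v → edge u v ≡ true → v ≢ swap u
  edge⇒≢swap (inj₁ x) (inj₂ .x) xx refl = case trans (≡sym (cross-irrefl x)) xx of λ ()
  edge⇒≢swap (inj₂ x) (inj₁ .x) xx refl = case trans (≡sym (cross-irrefl x)) xx of λ ()

  graph : RegularGraph V (m + suc j)
  graph = record
    { edge = edge
    ; edge-sym = edge-sym
    ; edge-irrefl = λ { (inj₁ x) → distinct-irrefl x ; (inj₂ x) → distinct-irrefl x }
    ; degree = λ { (inj₁ x) → count-⊎ (count-distinct x) (rows x)
                 ; (inj₂ x) → subst (HasCount _) (+-comm (suc j) m) (count-⊎ (columns x) (count-distinct x)) }
    ; root = inj₁ zero
    ; connect = λ { (inj₁ x) → within₁ x zero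
                  ; (inj₂ x) → within₂ x y₀ ◅◅ (zero-y₀ ◅ ε) }
    }
    where
    y₀ = proj₁ (count-inhabited (rows zero))
    zero-y₀ = proj₂ (count-inhabited (rows zero))
    within₁ : ∀ x y → Star (λ u v → edge u v ≡ true) (inj₁ x) (inj₁ y)
    within₁ x y with x ≟ y
    ... | yes refl = ε
    ... | no x≢y   = distinct-complete x≢y ◅ ε
    within₂ : ∀ x y → Star (λ u v → edge u v ≡ true) (inj₂ x) (inj₂ y)
    within₂ x y with x ≟ y
    ... | yes refl = ε
    ... | no x≢y   = distinct-complete x≢y ◅ ε

-- Only the pairs exchanged by `swap` are non-adjacent, so the order is `k + 2`, the minimum for
-- even `k`.
module CocktailParty (j : ℕ) =
  TwoCliques {suc j} distinct? distinct-irrefl count-distinct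
    (λ y → count-cong (λ x → mk⇔ (trans (distinct-sym x y)) (trans (distinct-sym y x))) (count-distinct y))

pred↻ : ∀ {n} → Fin (suc n) → Fin (suc n)
pred↻ zero    = fromℕ _
pred↻ (suc i) = inject₁ i

suc↻ : ∀ {n} → Fin (suc n) → Fin (suc n)
suc↻ i with view i
... | ‵fromℕ     = zero
... | ‵inject₁ j = suc j

pred↻-suc↻ : ∀ {n} (i : Fin (suc n)) → pred↻ (suc↻ i) ≡ i
pred↻-suc↻ i with view i
... | ‵fromℕ     = refl
... | ‵inject₁ j = refl

suc↻-pred↻ : ∀ {n} (i : Fin (suc n)) → suc↻ (pred↻ i) ≡ i
suc↻-pred↻ {n} zero rewrite view-fromℕ n = refl
suc↻-pred↻ (suc i) rewrite view-inject₁ i = refl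

pred↻-free : ∀ {n} (i : Fin (suc (suc n))) → pred↻ i ≢ i
pred↻-free (suc i) eq = 1+n≢n (trans (cong toℕ (≡sym eq)) (toℕ-inject₁ i))

-- The non-edges form a single cycle of length 2(j + 3).
module CycleComplement (j : ℕ) where

  m : ℕ
  m = suc (suc j)

  cross : Fin (suc m) → Fin (suc m) → Bool
  cross x y = distinct? x y ∧ distinct? (pred↻ x) y

  count-two : ∀ (x x' : Fin (suc m)) → x ≢ x' → HasCount (λ y → distinct? x y ∧ distinct? x' y ≡ true) (suc j)
  count-two x x' x≢x' = count-cong
    (λ y → mk⇔ (λ (xy , y≢x') → cong₂ _∧_ xy (distinct-complete (≢-sym y≢x')))
               (λ eq → proj₁ (∧-true eq) , ≢-sym (distinct-sound x' y (proj₂ (∧-true {distinct? x y} eq)))))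
    (count-remove x' (distinct-complete x≢x') (count-distinct x))

  rows : ∀ x → HasCount (λ y → cross x y ≡ true) (suc j)
  rows x = count-two x (pred↻ x) (≢-sym (pred↻-free x))

  -- The non-neighbours of `y` in the other clique are `y` and its cyclic successor, since
  -- `pred↻ x ≡ y` means `x ≡ suc↻ y`.
  columns : ∀ y → HasCount (λ x → cross x y ≡ true) (suc j)
  columns y = count-cong
    (λ x → let eq = cong₂ _∧_ (distinct-sym y x) (moved x) in mk⇔ (trans (≡sym eq)) (trans eq))
    (count-two y (suc↻ y) λ y≡ → pred↻-free (suc↻ y) (trans (pred↻-suc↻ y) y≡))
    where
    moved : ∀ x → distinct? (suc↻ y) x ≡ distinct? (pred↻ x) y
    moved x = ≡-from-⇔
      (λ eq → distinct-complete {x = pred↻ x} {y} λ p → distinct-sound (suc↻ y) x eq (trans (cong suc↻ (≡sym p)) (suc↻-pred↻ x)))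
      (λ eq → distinct-complete {x = suc↻ y} {x} λ p → distinct-sound (pred↻ x) y eq (trans (cong pred↻ (≡sym p)) (pred↻-suc↻ y)))

  open TwoCliques cross (λ x → cong (_∧ distinct? (pred↻ x) x) (distinct-irrefl x)) rows columns public

-- Peripheral graphs: thickened 8-cycles

Layered : ℕ → ℕ → Set
Layered Q' e = (Fin 8 × Fin (suc Q')) ⊎ Fin e

three-levels : ∀ l → length (filter (λ i → levelDist l i ≤? 1) (allFin 8)) ≡ 3
three-levels = from-yes (all? λ l → length (filter (λ i → levelDist l i ≤? 1) (allFin 8)) ℕₚ.≟ 3)

-- Any three cyclically consecutive levels together need at least k + 1 vertices.  All eight levels have
-- size Q; where that is too little, extra vertices are placed, at most one per level.
module Levels {Q' e : ℕ} (extra : Fin e → Fin 8) where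

  Q = suc Q'
  V = Layered Q' e

  level : V → Fin 8
  level (inj₁ (i , _)) = i
  level (inj₂ x)       = extra x

  index : V → Fin Q
  index (inj₁ (_ , j)) = j
  index (inj₂ _)       = zero

  Near : Fin 8 → Fin 8 → Set
  Near i j = levelDist i j ≤ 1

  near? : ∀ i j → Dec (Near i j)
  near? i j = levelDist i j ≤? 1

  near-refl : ∀ i → Near i i
  near-refl i rewrite levelDist-self i = z≤n

  near-sym : ∀ i j → Near i j → Near j i
  near-sym = from-yes (all? λ i → all? λ j → near? i j →-dec near? j i)

  extras-near : Fin 8 → ℕ
  extras-near l = length (filter (λ x → near? l (extra x)) (allFin e))

  count-near : ∀ l → HasCount (λ y → Near l (level y)) (3 * Q + extras-near l)
  count-near l = count-⊎
    (count-proj₁ Q (subst (HasCount _) (three-levels l) (count-filter (near? l))))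
    (count-filter (λ x → near? l (extra x)))

  _≟V_ : (x y : V) → Dec (x ≡ y)
  _≟V_ = Sumₚ.≡-dec (Productₚ.≡-dec _≟_ _≟_) _≟_

  -- Leaving out the edges of the matching μ brings the vertices with k + 1 near neighbours down to degree k.
  module Matched (μ : V → V) (μ-involutive : ∀ x → μ (μ x) ≡ x) (μ-near : ∀ x → Near (level x) (level (μ x)))
    {k : ℕ} (excess : ∀ x → (μ x ≡ x × 3 * Q + extras-near (level x) ≡ suc k) ⊎
                             (μ x ≢ x × 3 * Q + extras-near (level x) ≡ suc (suc k)))
    (bridge : ∀ x → μ x ≢ x → ∃[ z ] (Near (level x) (level z) × Near (level z) (level (μ x)) × z ≢ x × z ≢ μ x)) where

    Adjacent : V → V → Set
    Adjacent x y = (Near (level x) (level y) × y ≢ x) × y ≢ μ x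

    adjacent? : ∀ x y → Dec (Adjacent x y)
    adjacent? x y = (near? (level x) (level y) ×-dec ¬? (y ≟V x)) ×-dec ¬? (y ≟V μ x)

    edge : V → V → Bool
    edge x y = does (adjacent? x y)

    adjacent-sym : ∀ x y → Adjacent x y → Adjacent y x
    adjacent-sym x y ((near , y≢x) , y≢μx) = (near-sym (level x) (level y) near , ≢-sym y≢x) ,
      λ x≡μy → y≢μx (trans (≡sym (μ-involutive y)) (cong μ (≡sym x≡μy)))

    count-adjacent : ∀ x → HasCount (Adjacent x) k
    count-adjacent x with excess x
    ... | inj₁ (μx≡x , eq) = count-cong
            (λ y → mk⇔ (λ (near , y≢x) → (near , y≢x) , λ y≡μx → y≢x (trans y≡μx μx≡x)) proj₁)
            (count-remove x (near-refl (level x)) (subst (HasCount _) eq (count-near (level x))))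
    ... | inj₂ (μx≢x , eq) =
            count-remove (μ x) (μ-near x , μx≢x)
              (count-remove x (near-refl (level x)) (subst (HasCount _) eq (count-near (level x))))

    Path : V → V → Set
    Path = Star (λ x y → edge x y ≡ true)

    link : ∀ x y → Adjacent x y → edge x y ≡ true
    link x y = dec-true (adjacent? x y)

    -- Near vertices are adjacent unless equal or matched; a deleted matching edge is replaced by a
    -- path of length two through `bridge`.
    near-path : ∀ x y → Near (level x) (level y) → Path x y
    near-path x y near with y ≟V x | y ≟V μ x
    ... | yes refl | _        = ε
    ... | no y≢x   | no y≢μx  = link x y ((near , y≢x) , y≢μx) ◅ ε
    ... | no y≢x   | yes refl with bridge x y≢x
    ...   | z , xz , zy , z≢x , z≢μx =
            link x z ((xz , z≢x) , z≢μx) ◅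
            link z (μ x) ((zy , ≢-sym z≢μx) , λ eq → z≢x (trans (≡sym (μ-involutive z)) (trans (cong μ (≡sym eq)) (μ-involutive x)))) ◅ ε

    hub : Fin 8 → V
    hub i = inj₁ (i , zero)

    hub-path : ∀ i → Path (hub i) (hub zero)
    hub-path = <-weakInduction (λ i → Path (hub i) (hub zero)) ε
      (λ i p → near-path (hub (suc i)) (hub (inject₁ i)) (consecutive i) ◅◅ p)
      where
      consecutive : ∀ i → Near (suc i) (inject₁ i)
      consecutive = from-yes (all? λ i → near? (suc i) (inject₁ i))

    graph : RegularGraph V k
    graph = record
      { edge = edge
      ; edge-sym = λ x y → ≡-from-⇔
          (dec-true (adjacent? y x) ∘ adjacent-sym x y ∘ does-sound (adjacent? x y))
          (dec-true (adjacent? x y) ∘ adjacent-sym y x ∘ does-sound (adjacent? y x))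
      ; edge-irrefl = λ x → dec-false (adjacent? x x) (λ { ((_ , x≢x) , _) → x≢x refl })
      ; degree = λ x → count-cong (λ y → mk⇔ (link x y) (does-sound (adjacent? x y))) (count-adjacent x)
      ; root = hub zero
      ; connect = λ x → near-path x (hub (level x)) (near-refl (level x)) ◅◅ hub-path (level x)
      }

    edge-near : ∀ x y → edge x y ≡ true → Near (level x) (level y)
    edge-near x y xy = proj₁ (proj₁ (does-sound (adjacent? x y) xy))

  -- `τ` exchanges neighbouring levels that see `a + 1` extra vertices and fixes those that see `a`.
  -- Matching corresponding vertices of exchanged levels lowers exactly the degrees that are one too
  -- large.
  module LevelSwap {k a : ℕ} (τ : Fin 8 → Fin 8) (ε' : Fin e → Fin e)
    (τ-involutive : ∀ i → τ (τ i) ≡ i) (ε-involutive : ∀ x → ε' (ε' x) ≡ x)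
    (τ-near : ∀ i → Near i (τ i)) (extra-ε : ∀ x → extra (ε' x) ≡ τ (extra x))
    (ε-fixed : ∀ x → τ (extra x) ≡ extra x → ε' x ≡ x)
    (size : 3 * Q + a ≡ suc k)
    (extras : ∀ i → (τ i ≡ i × extras-near i ≡ a) ⊎ (τ i ≢ i × extras-near i ≡ suc a))
    (occupied : ∀ i → τ i ≢ i → ∃[ x ] extra x ≡ i) where

    μ : V → V
    μ (inj₁ (i , j)) = inj₁ (τ i , j)
    μ (inj₂ x)       = inj₂ (ε' x)

    level-μ : ∀ x → level (μ x) ≡ τ (level x)
    level-μ (inj₁ _) = refl
    level-μ (inj₂ x) = extra-ε x

    μ-fixed : ∀ x → τ (level x) ≡ level x → μ x ≡ x
    μ-fixed (inj₁ (i , j)) eq = cong (λ i → inj₁ (i , j)) eq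
    μ-fixed (inj₂ x)       eq = cong inj₂ (ε-fixed x eq)

    near-τ : ∀ x z → level z ≡ level x → Near (level x) (level z) × Near (level z) (level (μ x))
    near-τ x z eq rewrite eq | level-μ x = near-refl (level x) , τ-near (level x)

    moved : ∀ x → μ x ≢ x → τ (level x) ≢ level x
    moved x μx≢x eq = μx≢x (μ-fixed x eq)

    bridge : ∀ x → μ x ≢ x → ∃[ z ] (Near (level x) (level z) × Near (level z) (level (μ x)) × z ≢ x × z ≢ μ x)
    -- Another vertex on the level of `x` works. Taking it of the other kind, extra for layered and
    -- conversely, makes it differ from `x` and `μ x`.
    bridge x@(inj₁ (i , _)) μx≢x with occupied i (moved x μx≢x)
    ... | y , eq = let p , q = near-τ x (inj₂ y) eq in inj₂ y , p , q , (λ ()) , (λ ())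
    bridge x@(inj₂ y) μx≢x =
      let z = inj₁ (extra y , zero)
          p , q = near-τ x z refl
      in z , p , q , (λ ()) , (λ ())

    excess : ∀ x → (μ x ≡ x × 3 * Q + extras-near (level x) ≡ suc k) ⊎
                   (μ x ≢ x × 3 * Q + extras-near (level x) ≡ suc (suc k))
    excess x with extras (level x)
    ... | inj₁ (fixed , eq) = inj₁ (μ-fixed x fixed , trans (cong (3 * Q +_) eq) size)
    ... | inj₂ (moves , eq) = inj₂ ((λ μx≡x → moves (trans (≡sym (level-μ x)) (cong level μx≡x))) ,
                                     trans (cong (3 * Q +_) eq) (trans (+-suc (3 * Q) a) (cong suc size)))

    μ-involutive : ∀ x → μ (μ x) ≡ x
    μ-involutive (inj₁ (i , j)) = cong (λ i → inj₁ (i , j)) (τ-involutive i)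
    μ-involutive (inj₂ x)       = cong inj₂ (ε-involutive x)

    open Matched μ μ-involutive (λ x → proj₂ (near-τ x x refl)) excess bridge public

-- Here `k = 3Q + 1`, so three consecutive levels need two extra vertices. Omitting levels 0 and 3
-- gives exactly two, except for three around levels 5 and 6, which are therefore exchanged.
module Six (Q' : ℕ) where

  extra : Fin 6 → Fin 8
  extra = Vec.lookup (1F ∷ 2F ∷ 4F ∷ 5F ∷ 6F ∷ 7F ∷ [])

  open Levels {Q'} extra

  τ : Fin 8 → Fin 8
  τ = Vec.lookup (0F ∷ 1F ∷ 2F ∷ 3F ∷ 4F ∷ 6F ∷ 5F ∷ 7F ∷ [])

  swapped : Fin 6 → Fin 6
  swapped = Vec.lookup (0F ∷ 1F ∷ 2F ∷ 4F ∷ 3F ∷ 5F ∷ [])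

  open LevelSwap {k = 3 * suc Q' + 1} {a = 2} τ swapped
    (from-yes (all? λ i → τ (τ i) ≟ i)) (from-yes (all? λ x → swapped (swapped x) ≟ x))
    (from-yes (all? λ i → near? i (τ i))) (from-yes (all? λ x → extra (swapped x) ≟ τ (extra x)))
    (from-yes (all? λ x → (τ (extra x) ≟ extra x) →-dec (swapped x ≟ x)))
    (+-suc (3 * suc Q') 1)
    (from-yes (all? λ i → ((τ i ≟ i) ×-dec (extras-near i ℕₚ.≟ 2)) ⊎-dec (¬? (τ i ≟ i) ×-dec (extras-near i ℕₚ.≟ 3))))
    (from-yes (all? λ i → ¬? (τ i ≟ i) →-dec any? (λ x → extra x ≟ i))) public

-- Here `k = 3Q`, so three consecutive levels need one extra vertex. Placing four as adjacent pairs
-- 7, 0 and 3, 4 leaves an excess exactly on these levels, and each pair is matched across.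
module Four (Q' : ℕ) where

  extra : Fin 4 → Fin 8
  extra = Vec.lookup (0F ∷ 3F ∷ 4F ∷ 7F ∷ [])

  open Levels {Q'} extra

  τ : Fin 8 → Fin 8
  τ = Vec.lookup (7F ∷ 1F ∷ 2F ∷ 4F ∷ 3F ∷ 5F ∷ 6F ∷ 0F ∷ [])

  swapped : Fin 4 → Fin 4
  swapped = Vec.lookup (3F ∷ 2F ∷ 1F ∷ 0F ∷ [])

  open LevelSwap {k = 3 * suc Q'} {a = 1} τ swapped
    (from-yes (all? λ i → τ (τ i) ≟ i)) (from-yes (all? λ x → swapped (swapped x) ≟ x))
    (from-yes (all? λ i → near? i (τ i))) (from-yes (all? λ x → extra (swapped x) ≟ τ (extra x)))
    (from-yes (all? λ x → (τ (extra x) ≟ extra x) →-dec (swapped x ≟ x)))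
    (+-comm (3 * suc Q') 1)
    (from-yes (all? λ i → ((τ i ≟ i) ×-dec (extras-near i ℕₚ.≟ 1)) ⊎-dec (¬? (τ i ≟ i) ×-dec (extras-near i ℕₚ.≟ 2))))
    (from-yes (all? λ i → ¬? (τ i ≟ i) →-dec any? (λ x → extra x ≟ i))) public

-- Here `3Q = k + 1`, so three full levels already form a closed neighbourhood of the right size and
-- no edge is removed.
module Zero (Q' : ℕ) where

  extra : Fin 0 → Fin 8
  extra ()

  open Levels {Q'} extra

  open LevelSwap {k = 2 + Q' * 3} {a = 0} id id
    (λ _ → refl) (λ _ → refl) near-refl (λ _ → refl) (λ _ _ → refl)
    (trans (+-identityʳ (3 * suc Q')) (*-comm 3 (suc Q'))) (λ _ → inj₁ (refl , refl)) (λ _ moves → ⊥-elim (moves refl)) public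

-- Only level 7 has vertices of excessive degree, so it is matched within itself; this needs Q even.
module Three (s' : ℕ) where

  s = suc s'

  extra : Fin 3 → Fin 8
  -- Steps of three do not close up on eight levels: level 7 sees both 6 and 0, every other level
  -- exactly one of the three.
  extra = Vec.lookup (0F ∷ 3F ∷ 6F ∷ [])

  open Levels {s' + s} extra

  mate : Fin (s + s) → Fin (s + s)
  mate i = join s s (swap (splitAt s i))

  mate-involutive : ∀ i → mate (mate i) ≡ i
  mate-involutive i = begin
    join s s (swap (splitAt s (mate i))) ≡⟨ cong (join s s ∘ swap) (splitAt-join s s (swap (splitAt s i))) ⟩
    join s s (swap (swap (splitAt s i))) ≡⟨ cong (join s s) (Sumₚ.swap-involutive (splitAt s i)) ⟩
    join s s (splitAt s i)               ≡⟨ join-splitAt s s i ⟩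
    i                                    ∎
    where open ≡-Reasoning

  mate-free : ∀ i → mate i ≢ i
  mate-free i eq with splitAt s i | trans (≡sym (splitAt-join s s (swap (splitAt s i)))) (cong (splitAt s) eq)
  ... | inj₁ _ | ()
  ... | inj₂ _ | ()

  μ : V → V
  μ (inj₁ (i , j)) = if does (i ≟ 7F) then inj₁ (i , mate j) else inj₁ (i , j)
  μ (inj₂ x)       = inj₂ x

  level-μ : ∀ x → level (μ x) ≡ level x
  level-μ (inj₁ (i , j)) with i ≟ 7F
  ... | yes _ = refl
  ... | no _  = refl
  level-μ (inj₂ x) = refl

  μ-involutive : ∀ x → μ (μ x) ≡ x
  μ-involutive (inj₁ (i , j)) with i ≟ 7F in eq
  ... | yes _ rewrite eq = cong (λ j → inj₁ (i , j)) (mate-involutive j)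
  ... | no _  rewrite eq = refl
  μ-involutive (inj₂ x) = refl

  size : ∀ {a b} → a ≡ b → 3 * suc (s' + s) + a ≡ b + 3 * suc (s' + s)
  size {a} refl = +-comm (3 * suc (s' + s)) a

  extras-elsewhere : ∀ i → i ≢ 7F → extras-near i ≡ 1
  extras-elsewhere = from-yes (all? λ i → ¬? (i ≟ 7F) →-dec (extras-near i ℕₚ.≟ 1))

  extra-elsewhere : ∀ x → extra x ≢ 7F
  extra-elsewhere = from-yes (all? λ x → ¬? (extra x ≟ 7F))

  excess : ∀ x → (μ x ≡ x × 3 * suc (s' + s) + extras-near (level x) ≡ suc (3 * suc (s' + s))) ⊎
                 (μ x ≢ x × 3 * suc (s' + s) + extras-near (level x) ≡ suc (suc (3 * suc (s' + s))))
  excess (inj₁ (i , j)) with i ≟ 7F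
  ... | yes refl = inj₂ ((λ eq → mate-free j (cong proj₂ (inj₁-injective eq))) , size refl)
  ... | no i≢7   = inj₁ (refl , size (extras-elsewhere i i≢7))
  excess (inj₂ x) = inj₁ (refl , size (extras-elsewhere (extra x) (extra-elsewhere x)))

  bridge : ∀ x → μ x ≢ x → ∃[ z ] (Near (level x) (level z) × Near (level z) (level (μ x)) × z ≢ x × z ≢ μ x)
  bridge (inj₁ (i , j)) μx≢x with i ≟ 7F
  ... | yes refl = inj₁ (6F , zero) , s≤s z≤n , s≤s z≤n , (λ ()) , (λ ())
  ... | no _     = ⊥-elim (μx≢x refl)
  bridge (inj₂ x) μx≢x = ⊥-elim (μx≢x refl)

  open Matched μ μ-involutive (λ x → subst (Near (level x)) (≡sym (level-μ x)) (near-refl (level x))) excess bridge public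

-- Sufficiency of the order condition

opposite-level : Fin 8 → Fin 8
opposite-level = Vec.lookup (4F ∷ 5F ∷ 6F ∷ 7F ∷ 0F ∷ 1F ∷ 2F ∷ 3F ∷ [])

-- Every annular vertex has to be a foot, but a single level may have fewer than `m` vertices; hence
-- two maps.
module Feet {Q' e m : ℕ} (extra : Fin e → Fin 8) (ρ₀ ρ₁ : Fin (suc Q') → Fin m)
  (cover : ∀ x → (∃[ j ] ρ₀ j ≡ x) ⊎ (∃[ j ] ρ₁ j ≡ x)) where

  open Levels {Q'} extra

  VA = Fin (suc m) ⊎ Fin (suc m)

  -- Feet at the levels 3 and 7 are kept apart from those at 0 and 4: otherwise two opposite
  -- peripheral vertices would come too close.
  foot : Fin 8 → Fin Q → VA
  foot 0F j = inj₁ (suc (ρ₀ j))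
  foot 1F j = inj₁ (suc (ρ₁ j))
  foot 2F j = inj₁ (suc (ρ₁ j))
  foot 3F j = inj₁ zero
  foot 4F j = inj₂ (suc (ρ₀ j))
  foot 5F j = inj₂ (suc (ρ₁ j))
  foot 6F j = inj₂ (suc (ρ₁ j))
  foot 7F j = inj₂ zero

  f : V → VA
  f x = foot (level x) (index x)

  -- The side of a foot and whether it is `zero` depend on the level alone. Comparing these two bits
  -- turns both foot conditions into checks over pairs of levels.
  class : VA → Bool × Bool
  class (inj₁ zero)    = true , true
  class (inj₁ (suc _)) = true , false
  class (inj₂ zero)    = false , true
  class (inj₂ (suc _)) = false , false

  level-class : Fin 8 → Bool × Bool
  level-class i = does (toℕ i <? 4) , does ((i ≟ 3F) ⊎-dec (i ≟ 7F))

  class-foot : ∀ i j → class (foot i j) ≡ level-class i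
  class-foot 0F j = refl
  class-foot 1F j = refl
  class-foot 2F j = refl
  class-foot 3F j = refl
  class-foot 4F j = refl
  class-foot 5F j = refl
  class-foot 6F j = refl
  class-foot 7F j = refl

  class-swap : ∀ a → class (swap a) ≡ (not (proj₁ (class a)) , proj₂ (class a))
  class-swap (inj₁ zero)    = refl
  class-swap (inj₁ (suc _)) = refl
  class-swap (inj₂ zero)    = refl
  class-swap (inj₂ (suc _)) = refl

  class? : (a b : Bool × Bool) → Dec (a ≡ b)
  class? = Productₚ.≡-dec Boolₚ._≟_ Boolₚ._≟_

  same-foot : ∀ x t → f x ≡ f t → levelDist (level x) (level t) ≤ 2
  same-foot x t eq = same-class (level x) (level t)
    (trans (≡sym (class-foot (level x) (index x))) (trans (cong class eq) (class-foot (level t) (index t))))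
    where
    same-class : ∀ i j → level-class i ≡ level-class j → levelDist i j ≤ 2
    same-class = from-yes (all? λ i → all? λ j → class? (level-class i) (level-class j) →-dec (levelDist i j ≤? 2))

  opposite-foot : ∀ x t → f x ≡ swap (f t) → 2 ≤ levelDist (level x) (level t)
  opposite-foot x t eq = opposite-class (level x) (level t)
    (trans (≡sym (class-foot (level x) (index x))) (trans (cong class eq) (trans (class-swap (f t))
      (cong (λ (b , c) → not b , c) (class-foot (level t) (index t))))))
    where
    opposite-class : ∀ i j → level-class i ≡ (not (proj₁ (level-class j)) , proj₂ (level-class j)) → 2 ≤ levelDist i j
    opposite-class = from-yes (all? λ i → all? λ j →
      class? (level-class i) (not (proj₁ (level-class j)) , proj₂ (level-class j)) →-dec (2 ≤? levelDist i j))

  foot-opposite : ∀ i j → foot i j ≡ swap (foot (opposite-level i) j)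
  foot-opposite 0F j = refl
  foot-opposite 1F j = refl
  foot-opposite 2F j = refl
  foot-opposite 3F j = refl
  foot-opposite 4F j = refl
  foot-opposite 5F j = refl
  foot-opposite 6F j = refl
  foot-opposite 7F j = refl

  antipode : ∀ t → ∃[ x ] (f t ≡ swap (f x) × levelDist (level t) (level x) ≡ 4)
  antipode t = inj₁ (opposite-level (level t) , index t) , foot-opposite (level t) (index t) , opposite (level t)
    where
    opposite : ∀ i → levelDist i (opposite-level i) ≡ 4
    opposite = from-yes (all? λ i → levelDist i (opposite-level i) ℕₚ.≟ 4)

  f-surjective : ∀ a → ∃[ t ] f t ≡ a
  f-surjective (inj₁ zero) = inj₁ (3F , zero) , refl
  f-surjective (inj₁ (suc x)) with cover x
  ... | inj₁ (j , eq) = inj₁ (0F , j) , cong (inj₁ ∘ suc) eq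
  ... | inj₂ (j , eq) = inj₁ (1F , j) , cong (inj₁ ∘ suc) eq
  f-surjective (inj₂ zero) = inj₁ (7F , zero) , refl
  f-surjective (inj₂ (suc x)) with cover x
  ... | inj₁ (j , eq) = inj₁ (4F , j) , cong (inj₂ ∘ suc) eq
  ... | inj₂ (j , eq) = inj₁ (5F , j) , cong (inj₂ ∘ suc) eq

clamp : ∀ {m} → ℕ → Fin (suc m)
clamp {m} i with i <? suc m
... | yes i<m = fromℕ< i<m
... | no  _   = zero

clamp-toℕ : ∀ {m} (x : Fin (suc m)) → clamp (toℕ x) ≡ x
clamp-toℕ {m} x with toℕ x <? suc m
... | yes x<m = fromℕ<-toℕ x x<m
... | no  x≮m = ⊥-elim (x≮m (toℕ<n x))

-- Together the two maps run through all numbers below `2Q`; the default value of `clamp` only makes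
-- them total.
clamp-cover : ∀ {Q m} → suc m ≤ Q + Q → (x : Fin (suc m)) →
              (∃[ j ] clamp (toℕ {Q} j) ≡ x) ⊎ (∃[ j ] clamp (Q + toℕ {Q} j) ≡ x)
clamp-cover {Q} m≤2Q x with toℕ x <? Q
... | yes x<Q = inj₁ (fromℕ< x<Q , trans (cong clamp (toℕ-fromℕ< x<Q)) (clamp-toℕ x))
... | no  x≮Q = inj₂ (fromℕ< x∸Q<Q , trans (cong clamp (trans (cong (Q +_) (toℕ-fromℕ< x∸Q<Q)) (m+[n∸m]≡n Q≤x))) (clamp-toℕ x))
  where
  Q≤x = ≮⇒≥ x≮Q
  x∸Q<Q : toℕ x ∸ Q < Q
  x∸Q<Q = +-cancelˡ-< Q (toℕ x ∸ Q) Q (subst (_< Q + Q) (≡sym (m+[n∸m]≡n Q≤x)) (<-≤-trans (toℕ<n x) m≤2Q))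

AnnularGraph : ℕ → ℕ → Set
AnnularGraph m k = Σ (RegularGraph (Fin (suc (suc m)) ⊎ Fin (suc (suc m))) k) λ H →
  ∀ a b → RegularGraph.edge H a b ≡ true → b ≢ swap a

PeripheralGraph : ℕ → ℕ → ℕ → Set
PeripheralGraph Q' e k = Σ (Fin e → Fin 8) λ extra → Σ (RegularGraph (Layered Q' e) k) λ H →
  ∀ x y → RegularGraph.edge H x y ≡ true → levelDist (Levels.level extra x) (Levels.level extra y) ≤ 1

assemble : ∀ {k n c m Q' e} → RegularGraph (Fin c) k → AnnularGraph m k → PeripheralGraph Q' e k →
           suc m ≤ suc Q' + suc Q' → c + ((suc (suc m) + suc (suc m)) + (8 * suc Q' + e)) ≡ n →
           Σ (Graph n) (λ G → Connected G × MetricConnectedRegular G k)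
assemble {Q' = Q'} HC (HA , nonadjacent) (extra , HP , level-step) m≤2Q refl =
  Assembly.assembled HC HA HP (Sumₚ.≡-dec _≟_ _≟_) level f swap Sumₚ.swap-involutive
    (λ { (inj₁ _) () ; (inj₂ _) () }) nonadjacent level-step same-foot opposite-foot antipode f-surjective
    (↔-sym (↔-trans +↔⊎ (↔-refl ⊎-↔ ↔-trans +↔⊎ (+↔⊎ ⊎-↔ ↔-trans +↔⊎ (*↔× ⊎-↔ ↔-refl)))))
  where
  open Levels {Q'} extra
  open Feet extra (λ j → clamp (toℕ j)) (λ j → clamp (suc Q' + toℕ j)) (clamp-cover m≤2Q)

cocktail-party : ∀ j → AnnularGraph j (suc j + suc j)
cocktail-party j = CocktailParty.graph j , CocktailParty.edge⇒≢swap j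

cycle-complement : ∀ j → AnnularGraph (suc j) (suc (suc j) + suc j)
cycle-complement j = CycleComplement.graph j , CycleComplement.edge⇒≢swap j

zero-extras : ∀ Q' → PeripheralGraph Q' 0 (2 + Q' * 3)
zero-extras Q' = _ , Zero.graph Q' , Zero.edge-near Q'

three-extras : ∀ s' → PeripheralGraph (s' + suc s') 3 (3 * suc (s' + suc s'))
three-extras s' = _ , Three.graph s' , Three.edge-near s'

four-extras : ∀ Q' → PeripheralGraph Q' 4 (3 * suc Q')
four-extras Q' = _ , Four.graph Q' , Four.edge-near Q'

six-extras : ∀ Q' → PeripheralGraph Q' 6 (3 * suc Q' + 1)
six-extras Q' = _ , Six.graph Q' , Six.edge-near Q'

Realizable : ℕ → ℕ → Set
Realizable k n = Σ (Graph n) (λ G → Connected G × MetricConnectedRegular G k)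

≤-offset : ∀ {a b r} → a + r ≡ b → a ≤ b
≤-offset {a} {r = r} refl = m≤m+n a r

grow : ∀ {k m n} → m ≤ n → (∀ g → Realizable k (m + g)) → Realizable k n
grow {k} m≤n realize = let g , eq = m≤n⇒∃[o]m+o≡n m≤n in subst (Realizable k) eq (realize g)

even-gap : ∀ {m n} → 2 ∣ m → 2 ∣ n → m ≤ n → ∃[ t ] m + t * 2 ≡ n
even-gap 2∣m 2∣n m≤n with m≤n⇒∃[o]m+o≡n m≤n
... | g , refl with ∣m+n∣m⇒∣n 2∣n 2∣m
...   | divides t refl = t , refl

-- For odd `k` the center has even order, so surplus vertices come in pairs.
grow-even : ∀ {k m n} x → m ≡ x * 2 → n % 2 ≡ 0 → m ≤ n → (∀ t → Realizable k (m + t * 2)) → Realizable k n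
grow-even {k} {n = n} x m-even n-even m≤n realize =
  let t , eq = even-gap (divides x m-even) (m%n≡0⇒n∣m n 2 n-even) m≤n in subst (Realizable k) eq (realize t)

private
  -- In each case `central`, `annular` and `peripheral` match degrees with `k`, `room` gives enough
  -- peripheral vertices on two levels to reach all feet, `order` adds up the vertices, and `half`
  -- shows that the least order is even.
  central₁ : ∀ s → (1 + (2 + 3 * s)) + (1 + (2 + 3 * s)) ≡ (1 + s) * 2 * 3
  central₁ = solve-∀
  peripheral₁ : ∀ s → 3 * (1 + (s + (1 + s))) ≡ (1 + s) * 2 * 3
  peripheral₁ = solve-∀
  room₁ : ∀ s → 1 + (2 + 3 * s) + (s + 1) ≡ 1 + (s + (1 + s)) + (1 + (s + (1 + s)))
  room₁ = solve-∀
  order₁ : ∀ s g → 1 + ((1 + (2 + 3 * s)) + (g + (1 + (2 + 3 * s)))) + ((2 + (2 + 3 * s) + (2 + (2 + 3 * s))) + (8 * (1 + (s + (1 + s))) + 3)) ≡ 14 * ((1 + s) * 2) + 6 + g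
  order₁ = solve-∀
  central₂ : ∀ s → 1 + ((1 + 3 * s) + (1 + 3 * s)) ≡ (1 + s * 2) * 3
  central₂ = solve-∀
  annular₂ : ∀ s → 2 + 3 * s + (1 + 3 * s) ≡ (1 + s * 2) * 3
  annular₂ = solve-∀
  peripheral₂ : ∀ s → 3 * (1 + s * 2) ≡ (1 + s * 2) * 3
  peripheral₂ = solve-∀
  room₂ : ∀ s → 1 + (1 + 3 * s) + s ≡ 1 + s * 2 + (1 + s * 2)
  room₂ = solve-∀
  order₂ : ∀ s t → 1 + ((1 + 3 * s) + (t + (1 + (t + (1 + 3 * s))))) + ((2 + (1 + 3 * s) + (2 + (1 + 3 * s))) + (8 * (1 + s * 2) + 4)) ≡ 14 * (1 + s * 2) + 8 + t * 2
  order₂ = solve-∀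
  half₂ : ∀ s → 14 * (1 + s * 2) + 8 ≡ (7 * (1 + s * 2) + 4) * 2
  half₂ = solve-∀
  central₃ : ∀ s → 1 + ((1 + (2 + 3 * s)) + (1 + (2 + 3 * s))) ≡ 1 + (1 + s) * 2 * 3
  central₃ = solve-∀
  annular₃ : ∀ s → 2 + (2 + 3 * s) + (1 + (2 + 3 * s)) ≡ 1 + (1 + s) * 2 * 3
  annular₃ = solve-∀
  peripheral₃ : ∀ s → 3 * (1 + (1 + s * 2)) + 1 ≡ 1 + (1 + s) * 2 * 3
  peripheral₃ = solve-∀
  room₃ : ∀ s → 1 + (3 + 3 * s) + s ≡ 1 + (1 + s * 2) + (1 + (1 + s * 2))
  room₃ = solve-∀
  order₃ : ∀ s t → 1 + ((1 + (2 + 3 * s)) + (t + (1 + (t + (1 + (2 + 3 * s)))))) + ((2 + (3 + 3 * s) + (2 + (3 + 3 * s))) + (8 * (1 + (1 + s * 2)) + 6)) ≡ 14 * ((1 + s) * 2) + 12 + t * 2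
  order₃ = solve-∀
  half₃ : ∀ s → 14 * ((1 + s) * 2) + 12 ≡ (7 * ((1 + s) * 2) + 6) * 2
  half₃ = solve-∀
  central₄ : ∀ s → (1 + (1 + 3 * s)) + (1 + (1 + 3 * s)) ≡ 1 + (1 + s * 2) * 3
  central₄ = solve-∀
  peripheral₄ : ∀ s → 3 * (1 + s * 2) + 1 ≡ 1 + (1 + s * 2) * 3
  peripheral₄ = solve-∀
  room₄ : ∀ s → 1 + (1 + 3 * s) + s ≡ 1 + s * 2 + (1 + s * 2)
  room₄ = solve-∀
  order₄ : ∀ s g → 1 + ((1 + (1 + 3 * s)) + (g + (1 + (1 + 3 * s)))) + ((2 + (1 + 3 * s) + (2 + (1 + 3 * s))) + (8 * (1 + s * 2) + 6)) ≡ 14 * (1 + s * 2) + 11 + g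
  order₄ = solve-∀
  central₅ : ∀ s → (1 + 3 * s) + (1 + 3 * s) ≡ 2 + s * 2 * 3
  central₅ = solve-∀
  room₅ : ∀ s → 1 + 3 * s + (1 + s) ≡ 1 + s * 2 + (1 + s * 2)
  room₅ = solve-∀
  order₅ : ∀ s g → 1 + ((1 + 3 * s) + (g + (1 + 3 * s))) + ((2 + 3 * s + (2 + 3 * s)) + (8 * (1 + s * 2) + 0)) ≡ 14 * (s * 2) + 15 + g
  order₅ = solve-∀
  central₆ : ∀ s → 1 + ((1 + (1 + 3 * s)) + (1 + (1 + 3 * s))) ≡ 2 + (1 + s * 2) * 3
  central₆ = solve-∀
  annular₆ : ∀ s → 2 + (1 + 3 * s) + (1 + (1 + 3 * s)) ≡ 2 + (1 + s * 2) * 3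
  annular₆ = solve-∀
  room₆ : ∀ s → 1 + (2 + 3 * s) + (1 + s) ≡ 1 + (1 + s * 2) + (1 + (1 + s * 2))
  room₆ = solve-∀
  order₆ : ∀ s t → 1 + ((1 + (1 + 3 * s)) + (t + (1 + (t + (1 + (1 + 3 * s)))))) + ((2 + (2 + 3 * s) + (2 + (2 + 3 * s))) + (8 * (1 + (1 + s * 2)) + 0)) ≡ 14 * (1 + s * 2) + 16 + t * 2
  order₆ = solve-∀
  half₆ : ∀ s → 14 * (1 + s * 2) + 16 ≡ (7 * (1 + s * 2) + 8) * 2
  half₆ = solve-∀

realize₁ : ∀ {k n} q s → k ≡ q * 3 → q ≡ s * 2 → 2 ≤ k → 14 * q + 6 ≤ n → Realizable k n
realize₁ _ zero refl refl () _
realize₁ _ (suc s) refl refl _ bound = grow bound λ g → assemble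
  (subst (RegularGraph _) (central₁ s) (circulant-even (2 + 3 * s) g))
  (subst (AnnularGraph _) (central₁ s) (cocktail-party (2 + 3 * s)))
  (subst (PeripheralGraph _ _) (peripheral₁ s) (three-extras s))
  (≤-offset (room₁ s)) (order₁ s g)

realize₂ : ∀ {k n} q s → k ≡ q * 3 → q ≡ 1 + s * 2 → n % 2 ≡ 0 × 14 * q + 8 ≤ n → Realizable k n
realize₂ _ s refl refl (n-even , bound) = grow-even (7 * (1 + s * 2) + 4) (half₂ s) n-even bound λ t → assemble
  (subst (RegularGraph _) (central₂ s) (circulant-odd (3 * s) t))
  (subst (AnnularGraph _) (annular₂ s) (cycle-complement (3 * s)))
  (subst (PeripheralGraph _ _) (peripheral₂ s) (four-extras (s * 2)))
  (≤-offset (room₂ s)) (order₂ s t)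

realize₃ : ∀ {k n} q s → k ≡ 1 + q * 3 → q ≡ s * 2 → 2 ≤ k → n % 2 ≡ 0 × 14 * q + 12 ≤ n → Realizable k n
realize₃ _ zero refl refl (s≤s ()) _
realize₃ _ (suc s) refl refl _ (n-even , bound) = grow-even (7 * ((1 + s) * 2) + 6) (half₃ s) n-even bound λ t → assemble
  (subst (RegularGraph _) (central₃ s) (circulant-odd (2 + 3 * s) t))
  (subst (AnnularGraph _) (annular₃ s) (cycle-complement (2 + 3 * s)))
  (subst (PeripheralGraph _ _) (peripheral₃ s) (six-extras (1 + s * 2)))
  (≤-offset (room₃ s)) (order₃ s t)

realize₄ : ∀ {k n} q s → k ≡ 1 + q * 3 → q ≡ 1 + s * 2 → 14 * q + 11 ≤ n → Realizable k n
realize₄ _ s refl refl bound = grow bound λ g → assemble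
  (subst (RegularGraph _) (central₄ s) (circulant-even (1 + 3 * s) g))
  (subst (AnnularGraph _) (central₄ s) (cocktail-party (1 + 3 * s)))
  (subst (PeripheralGraph _ _) (peripheral₄ s) (six-extras (s * 2)))
  (≤-offset (room₄ s)) (order₄ s g)

realize₅ : ∀ {k n} q s → k ≡ 2 + q * 3 → q ≡ s * 2 → 14 * q + 15 ≤ n → Realizable k n
realize₅ _ s refl refl bound = grow bound λ g → assemble
  (subst (RegularGraph _) (central₅ s) (circulant-even (3 * s) g))
  (subst (AnnularGraph _) (central₅ s) (cocktail-party (3 * s)))
  (zero-extras (s * 2))
  (≤-offset (room₅ s)) (order₅ s g)

realize₆ : ∀ {k n} q s → k ≡ 2 + q * 3 → q ≡ 1 + s * 2 → n % 2 ≡ 0 × 14 * q + 16 ≤ n → Realizable k n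
realize₆ _ s refl refl (n-even , bound) = grow-even (7 * (1 + s * 2) + 8) (half₆ s) n-even bound λ t → assemble
  (subst (RegularGraph _) (central₆ s) (circulant-odd (1 + 3 * s) t))
  (subst (AnnularGraph _) (annular₆ s) (cycle-complement (1 + 3 * s)))
  (zero-extras (1 + s * 2))
  (≤-offset (room₆ s)) (order₆ s t)

sufficient : ∀ k n → 2 ≤ k → OrderCondition k n → Realizable k n
sufficient k n 2≤k (c₁ , c₂ , c₃ , c₄ , c₅ , c₆) = residue (k % 3) (q % 2) (m%n<n k 3) (m%n<n q 2) refl refl
  where
  q = k / 3
  s = q / 2
  residue : ∀ r b → r < 3 → b < 2 → k % 3 ≡ r → q % 2 ≡ b → Realizable k n
  residue 0 0 _ _ kr qr = realize₁ q s (euclid k 3 kr) (euclid q 2 qr) 2≤k (c₁ kr qr)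
  residue 0 1 _ _ kr qr = realize₂ q s (euclid k 3 kr) (euclid q 2 qr) (c₂ kr qr)
  residue 1 0 _ _ kr qr = realize₃ q s (euclid k 3 kr) (euclid q 2 qr) 2≤k (c₃ kr qr)
  residue 1 1 _ _ kr qr = realize₄ q s (euclid k 3 kr) (euclid q 2 qr) (c₄ kr qr)
  residue 2 0 _ _ kr qr = realize₅ q s (euclid k 3 kr) (euclid q 2 qr) (c₅ kr qr)
  residue 2 1 _ _ kr qr = realize₆ q s (euclid k 3 kr) (euclid q 2 qr) (c₆ kr qr)
  residue (suc (suc (suc _))) _ (s≤s (s≤s (s≤s ()))) _ _ _
  residue _ (suc (suc _)) _ (s≤s (s≤s ())) _ _

theorem9 : (k n : ℕ) → 2 ≤ k →
    (Σ (Graph n) (λ G → Connected G × MetricConnectedRegular G k)) ⇔ OrderCondition k n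
theorem9 k n 2≤k = mk⇔ (necessary k n) (sufficient k n 2≤k)
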